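{- Let $k \geq 2$ be an integer. The finite satisfiability problem and the infinite satisfiability problem for $\mathsf{BSR}(\mathsf{SL}^k)$ are both undecidable. That is, there is no algorithm that decides, given a $\mathsf{BSR}(\mathsf{SL}^k)$ sentence, whether it has a model with a finite universe. Likewise, there is no algorithm that decides, given such a sentence, whether it has a model with an infinite universe.
   Context: Fix an integer $k\ge 1$ and a countable set $\mathsf{Var}$ of variables. Formulae of Separation Logic $\mathsf{SL}^k$ are generated by $\varphi ::= \bot \mid \top \mid \mathsf{emp} \mid x\approx y \mid x\mapsto(y_1,\dots,y_k) \mid \varphi\wedge\varphi \mid \neg\varphi \mid \varphi * \varphi \mid \varphi \mathrel{ -\!\!*} \varphi \mid \exists x.\varphi$, where $x,y,y_1,\dots,y_k\in\mathsf{Var}$. They are interpreted over structures $(\mathfrak U,\mathfrak s,\mathfrak h)$. Here $\mathfrak U$ is a nonempty countable set (the universe, finite or infinite), $\mathfrak s$ maps variables to $\mathfrak U$ (the store), and $\mathfrak h:\mathfrak U\rightharpoonup\mathfrak U^k$ is a finite partial function (the heap). The semantics is as follows. - $\mathsf{emp}$ holds iff $\mathfrak h=\emptyset$. - $x\mapsto(y_1,\dots,y_k)$ holds iff $\mathfrak h=\{(\mathfrak s(x),(\mathfrak s(y_1),\dots,\mathfrak s(y_k)))\}$. - $\varphi_1*\varphi_2$ holds iff $\mathfrak h=\mathfrak h_1\uplus\mathfrak h_2$ for some heaps $\mathfrak h_1,\mathfrak h_2$ with disjoint domains such that $(\mathfrak U,\mathfrak s,\mathfrak h_i)\models\varphi_i$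 for $i=1,2$. - $\varphi_1\mathrel{ -\!\!*}\varphi_2$ holds iff for every heap $\mathfrak h'$ whose domain is disjoint from that of $\mathfrak h$ and with $(\mathfrak U,\mathfrak s,\mathfrak h')\models\varphi_1$, we have $(\mathfrak U,\mathfrak s,\mathfrak h\uplus\mathfrak h')\models\varphi_2$. - Equality, the boolean connectives and $\exists$ have the usual meaning, with $\exists$ ranging over $\mathfrak U$. $\mathsf{BSR}(\mathsf{SL}^k)$ is the set of sentences $\exists x_1\dots\exists x_n\forall y_1\dots\forall y_m.\phi$ with $\phi$ a quantifier-free $\mathsf{SL}^k$ formula. The finite (respectively infinite) satisfiability problem asks whether a given sentence has a model $(\mathfrak U,\mathfrak s,\mathfrak h)$ with $\mathfrak U$ finite (respectively infinite). -}

module Defs where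

open import Data.Nat using (ℕ; zero; suc; _+_; _*_; _<_; _≡ᵇ_)
open import Data.Fin using (Fin)
open import Data.Vec using (Vec; []; _∷_; toList) renaming (map to vmap)
open import Data.List using (List; []; _∷_)
open import Data.List.Membership.Propositional using (_∈_)
open import Data.Maybe using (Maybe; just; nothing)
open import Data.Product using (Σ; _×_; _,_)
open import Data.Sum using (_⊎_)
open import Data.Empty using (⊥)
open import Data.Unit using (⊤)
open import Data.Bool using (if_then_else_)
open import Relation.Nullary using (¬_)
open import Relation.Binary.PropositionalEquality using (_≡_; _≢_)
open import Function.Definitions using (Injective; Surjective)

Var : Set
Var = ℕ

data Formula (k : ℕ) : Set where
  ff tt emp  : Formula k
  _≈_        : Var → Var → Formula k
  _↦_        : Var → Vec Var k → Formula k
  _∧_        : Formula k → Formula k → Formula k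
  ¬ᶠ_        : Formula k → Formula k
  _⋆_        : Formula k → Formula k → Formula k
  _-⋆_       : Formula k → Formula k → Formula k
  ∃ᶠ         : Var → Formula k → Formula k

IsQF : ∀ {k} → Formula k → Set
IsQF ff = ⊤
IsQF tt = ⊤
IsQF emp = ⊤
IsQF (x ≈ y) = ⊤
IsQF (x ↦ ys) = ⊤
IsQF (φ ∧ ψ) = IsQF φ × IsQF ψ
IsQF (¬ᶠ φ) = IsQF φ
IsQF (φ ⋆ ψ) = IsQF φ × IsQF ψ
IsQF (φ -⋆ ψ) = IsQF φ × IsQF ψ
IsQF (∃ᶠ x φ) = ⊥

Free : ∀ {k} → Var → Formula k → Set
Free v ff = ⊥
Free v tt = ⊥
Free v emp = ⊥
Free v (x ≈ y) = v ≡ x ⊎ v ≡ y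
Free v (x ↦ ys) = v ≡ x ⊎ v ∈ toList ys
Free v (φ ∧ ψ) = Free v φ ⊎ Free v ψ
Free v (¬ᶠ φ) = Free v φ
Free v (φ ⋆ ψ) = Free v φ ⊎ Free v ψ
Free v (φ -⋆ ψ) = Free v φ ⊎ Free v ψ
Free v (∃ᶠ x φ) = v ≢ x × Free v φ

-- BSR(SL^k) sentences  ∃ xs ∀ ys . matrix,  matrix quantifier-free,
-- the whole sentence closed.
record BSR (k : ℕ) : Set where
  constructor bsr
  field
    exVars  : List Var
    allVars : List Var
    matrix  : Formula k
    qf      : IsQF matrix
    closed  : ∀ v → Free v matrix → v ∈ exVars ⊎ v ∈ allVars

Store : Set → Set
Store U = Var → U

Heap : Set → ℕ → Set
Heap U k = U → Maybe (Vec U k)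

FinDom : ∀ {U k} → Heap U k → Set
FinDom {U} h = Σ (List U) λ L → ∀ u v → h u ≡ just v → u ∈ L

Union : ∀ {U k} → Heap U k → Heap U k → Heap U k → Set
Union {U} h h₁ h₂ = ∀ (u : U) →
  (h₁ u ≡ nothing × h u ≡ h₂ u) ⊎ (h₂ u ≡ nothing × h u ≡ h₁ u)

_[_≔_] : ∀ {U} → Store U → Var → U → Store U
(s [ x ≔ u ]) v = if v ≡ᵇ x then u else s v

module Sem (U : Set) {k : ℕ} where
  ⟦_⟧ : Formula k → Store U → Heap U k → Set
  ⟦ ff ⟧ s h = ⊥
  ⟦ tt ⟧ s h = ⊤
  ⟦ emp ⟧ s h = ∀ u → h u ≡ nothing
  ⟦ x ≈ y ⟧ s h = s x ≡ s y
  ⟦ x ↦ ys ⟧ s h = h (s x) ≡ just (vmap s ys) × (∀ u → u ≢ s x → h u ≡ nothing)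
  ⟦ φ ∧ ψ ⟧ s h = ⟦ φ ⟧ s h × ⟦ ψ ⟧ s h
  ⟦ ¬ᶠ φ ⟧ s h = ¬ ⟦ φ ⟧ s h
  ⟦ φ ⋆ ψ ⟧ s h = Σ (Heap U k) λ h₁ → Σ (Heap U k) λ h₂ →
      FinDom h₁ × FinDom h₂ × Union h h₁ h₂ × ⟦ φ ⟧ s h₁ × ⟦ ψ ⟧ s h₂
  ⟦ φ -⋆ ψ ⟧ s h = ∀ (h′ h″ : Heap U k) → FinDom h′ → Union h″ h h′ →
      ⟦ φ ⟧ s h′ → ⟦ ψ ⟧ s h″
  ⟦ ∃ᶠ x φ ⟧ s h = Σ U λ u → ⟦ φ ⟧ (s [ x ≔ u ]) h

  Exs : List Var → (Store U → Set) → Store U → Set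
  Exs [] P s = P s
  Exs (x ∷ xs) P s = Σ U λ u → Exs xs P (s [ x ≔ u ])

  Alls : List Var → (Store U → Set) → Store U → Set
  Alls [] P s = P s
  Alls (x ∷ xs) P s = ∀ (u : U) → Alls xs P (s [ x ≔ u ])

  holds : BSR k → Store U → Heap U k → Set
  holds φ s h = Exs (BSR.exVars φ) (λ s′ → Alls (BSR.allVars φ) (λ s″ → ⟦ BSR.matrix φ ⟧ s″ h) s′) s

record Structure (k : ℕ) : Set₁ where
  field
    U        : Set
    elt      : U
    enc      : U → ℕ
    enc-inj  : Injective _≡_ _≡_ enc
    store    : Store U
    heap     : Heap U k
    heap-fin : FinDom heap

FiniteSet : Set → Set
FiniteSet U = Σ ℕ λ n → Σ (Fin n → U) λ f → Surjective _≡_ _≡_ f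

Models : ∀ {k} → Structure k → BSR k → Set
Models M φ = Sem.holds (Structure.U M) φ (Structure.store M) (Structure.heap M)

FinSat : ∀ {k} → BSR k → Set₁
FinSat {k} φ = Σ (Structure k) λ M → FiniteSet (Structure.U M) × Models M φ

InfSat : ∀ {k} → BSR k → Set₁
InfSat {k} φ = Σ (Structure k) λ M → ¬ FiniteSet (Structure.U M) × Models M φ

pair : ℕ → ℕ → ℕ
pair a b = (a + b) * (a + b) + b

codeL : List ℕ → ℕ
codeL [] = 0
codeL (x ∷ xs) = suc (pair x (codeL xs))

codeF : ∀ {k} → Formula k → ℕ
codeF ff = pair 0 0
codeF tt = pair 1 0
codeF emp = pair 2 0
codeF (x ≈ y) = pair 3 (pair x y)
codeF (x ↦ ys) = pair 4 (pair x (codeL (toList ys)))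
codeF (φ ∧ ψ) = pair 5 (pair (codeF φ) (codeF ψ))
codeF (¬ᶠ φ) = pair 6 (codeF φ)
codeF (φ ⋆ ψ) = pair 7 (pair (codeF φ) (codeF ψ))
codeF (φ -⋆ ψ) = pair 8 (pair (codeF φ) (codeF ψ))
codeF (∃ᶠ x φ) = pair 9 (pair x (codeF φ))

code : ∀ {k} → BSR k → ℕ
code φ = pair (codeL (BSR.exVars φ)) (pair (codeL (BSR.allVars φ)) (codeF (BSR.matrix φ)))

data PR : ℕ → Set where
  zeroF : ∀ {n} → PR n
  succF : PR 1
  projF : ∀ {n} → Fin n → PR n
  compF : ∀ {m n} → PR m → Vec (PR n) m → PR n
  recF  : ∀ {n} → PR n → PR (suc (suc n)) → PR (suc n)
  muF   : ∀ {n} → PR (suc n) → PR n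

mutual
  data _∙_⇓_ : ∀ {n} → PR n → Vec ℕ n → ℕ → Set where
    zero⇓ : ∀ {n} {xs : Vec ℕ n} → zeroF ∙ xs ⇓ 0
    succ⇓ : ∀ {x} → succF ∙ (x ∷ []) ⇓ suc x
    proj⇓ : ∀ {n} {i : Fin n} {xs} → projF i ∙ xs ⇓ Data.Vec.lookup xs i
    comp⇓ : ∀ {m n} {f : PR m} {gs : Vec (PR n) m} {xs ys y} →
            gs ∙* xs ⇓ ys → f ∙ ys ⇓ y → compF f gs ∙ xs ⇓ y
    rec0⇓ : ∀ {n} {f : PR n} {g} {xs y} → f ∙ xs ⇓ y → recF f g ∙ (0 ∷ xs) ⇓ y
    recS⇓ : ∀ {n} {f : PR n} {g} {x xs z y} → recF f g ∙ (x ∷ xs) ⇓ z →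
            g ∙ (x ∷ z ∷ xs) ⇓ y → recF f g ∙ (suc x ∷ xs) ⇓ y
    mu⇓   : ∀ {n} {f : PR (suc n)} {xs y} → f ∙ (y ∷ xs) ⇓ 0 →
            (∀ z → z < y → Σ ℕ λ v → f ∙ (z ∷ xs) ⇓ suc v) → muF f ∙ xs ⇓ y

  data _∙*_⇓_ : ∀ {m n} → Vec (PR n) m → Vec ℕ n → Vec ℕ m → Set where
    []⇓ : ∀ {n} {xs : Vec ℕ n} → [] ∙* xs ⇓ []
    ∷⇓  : ∀ {m n} {g : PR n} {gs : Vec (PR n) m} {xs y ys} →
          g ∙ xs ⇓ y → gs ∙* xs ⇓ ys → (g ∷ gs) ∙* xs ⇓ (y ∷ ys)

Decidable : ∀ {k} → (BSR k → Set₁) → Set₁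
Decidable {k} P = Σ (PR 1) λ f → ∀ (φ : BSR k) →
  (P φ → f ∙ (code φ ∷ []) ⇓ 1) × (¬ P φ → f ∙ (code φ ∷ []) ⇓ 0)

{-# OPTIONS --safe #-}
module Submission where

-- A diagonal argument. A heap over k ≥ 2 components stores a finite binary graph (components beyond the
-- second are forced to be nil), hence a big-step derivation tree "program p maps a to v": each judgement
-- node points to its program, argument, result and premises. Correctness of such a tree is a local
-- condition on every node, so it is a universally quantified Horn condition, and a fixed matrix, the
-- frame of p, says that the heap contains a correct derivation of result 0 for p on an input named by a
-- variable. Conjoining a chain of cells that makes this input the code n of the frame itself gives a
-- sentence whose code is a computable function s of n. For a candidate decision procedure f, take p to
-- be f after s. If f answers 0, the derivation tree of this run is a model, over the universe of its own
-- subtrees (finite) or of all trees (infinite); if f answers 1, following the actual run inside any model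
-- shows that the claimed result 0 is 1.

open import Defs
open import Data.Bool using (Bool; true; false; T; if_then_else_)
open import Data.Bool.Properties using (T-irrelevant)
open import Data.Empty using (⊥; ⊥-elim)
open import Data.Fin using (Fin; zero; suc; toℕ)
open import Data.Fin.Patterns using (0F; 1F; 2F)
open import Data.Fin.Properties using (pigeonhole; toℕ<n)
import Data.List
open import Data.List using (List; []; _∷_; _++_; downFrom; length; map)
open import Data.List.Membership.Propositional using (_∈_)
open import Data.List.Membership.Propositional.Properties using (∈-++⁺ˡ; ∈-++⁺ʳ; ∈-++⁻; ∈-downFrom⁺)
open import Data.List.Properties using (++-assoc; ++-identityʳ)
open import Data.List.Relation.Unary.All as All using (All; []; _∷_)
open import Data.List.Relation.Unary.Any using (here; there; index)
open import Data.List.Relation.Unary.Any.Properties using (lookup-index)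
open import Data.Maybe using (Maybe; just; nothing)
open import Data.Nat
open import Data.Nat.Properties
open import Data.Product using (Σ; _×_; _,_; proj₁; proj₂)
open import Data.Sum using (inj₁; inj₂)
open import Data.Unit using (⊤; tt)
open import Data.Vec using (Vec; []; _∷_; lookup; toList; replicate; tabulate)
  renaming (map to vmap)
import Data.Vec.Properties as Vecₚ
open import Relation.Binary.Definitions using (DecidableEquality; tri<; tri≈; tri>)
open import Relation.Binary.PropositionalEquality
open import Relation.Nullary using (Dec; yes; no; ¬_; contradiction)
open import Relation.Nullary.Decidable
  using (_×-dec_; decidable-stable; from-yes; fromWitness; toWitness; True; ⌊_⌋)

-- Computability of codes

-- A model may carry cycles, sharing and extra cells around the intended tree. They are tolerated
-- rather than excluded: soundness is an induction on the actual evaluation, and the rules only say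
-- what the premises of a judgement cell must be, so nothing off the path of that evaluation
-- matters. The rules reach descendants of bounded depth through universal variables, guarded by an
-- antecedent that reads the cells in between. A missing cell would make such a rule vacuous, so the
-- sentence also demands that children of cells be allocated. The wand expresses this without a
-- quantifier, and a finite heap can satisfy it because leaves point to themselves. The formula
-- cannot contain a numeral for its own code, hence the split into a frame with an open input
-- variable and a chain that fixes the input afterwards.

Computable : ∀ {n} → (Vec ℕ n → ℕ) → Set
Computable {n} F = Σ (PR n) λ p → ∀ xs → p ∙ xs ⇓ F xs

constant : ∀ {n} c → Computable {n} (λ _ → c)
constant zero    = zeroF , λ _ → zero⇓
constant (suc c) = let p , ok = constant c in
  compF succF (p ∷ []) , λ xs → comp⇓ (∷⇓ (ok xs) []⇓) succ⇓

projection : ∀ {n} (i : Fin n) → Computable (λ xs → lookup xs i)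
projection i = projF i , λ _ → proj⇓

compose₁ : ∀ {n} {F : Vec ℕ 1 → ℕ} {G : Vec ℕ n → ℕ} →
  Computable F → Computable G → Computable (λ xs → F (G xs ∷ []))
compose₁ (p , okp) (q , okq) =
  compF p (q ∷ []) , λ xs → comp⇓ (∷⇓ (okq xs) []⇓) (okp _)

compose₂ : ∀ {n} {F : Vec ℕ 2 → ℕ} {G H : Vec ℕ n → ℕ} →
  Computable F → Computable G → Computable H →
  Computable (λ xs → F (G xs ∷ H xs ∷ []))
compose₂ (p , okp) (q , okq) (r , okr) =
  compF p (q ∷ r ∷ []) , λ xs → comp⇓ (∷⇓ (okq xs) (∷⇓ (okr xs) []⇓)) (okp _)

-- `R` is any meta-level function that satisfies the two recursion equations, so codes of
-- recursively built formulas such as `chain` qualify.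
primitiveRecursion : ∀ {n} {F : Vec ℕ n → ℕ} {G : Vec ℕ (2 + n) → ℕ} {R : Vec ℕ (1 + n) → ℕ} →
  Computable F → Computable G →
  (∀ xs → F xs ≡ R (0 ∷ xs)) → (∀ x xs → G (x ∷ R (x ∷ xs) ∷ xs) ≡ R (suc x ∷ xs)) →
  Computable R
primitiveRecursion {R = R} (p , okp) (q , okq) base step = recF p q , λ { (x ∷ xs) → run x xs }
  where
  run : ∀ x xs → recF p q ∙ (x ∷ xs) ⇓ R (x ∷ xs)
  run zero    xs = subst (recF p q ∙ (0 ∷ xs) ⇓_) (base xs) (rec0⇓ (okp xs))
  run (suc x) xs = subst (recF p q ∙ (suc x ∷ xs) ⇓_) (step x xs) (recS⇓ (run x xs) (okq _))

successor : ∀ {n} {F : Vec ℕ n → ℕ} → Computable F → Computable (λ xs → suc (F xs))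
successor = compose₁ {F = λ { (x ∷ []) → suc x }} (succF , λ { (x ∷ []) → succ⇓ })

shift : ∀ {n} c {F : Vec ℕ n → ℕ} → Computable F → Computable (λ xs → c + F xs)
shift zero    F = F
shift (suc c) F = successor (shift c F)

addition : ∀ {n} {F G : Vec ℕ n → ℕ} → Computable F → Computable G → Computable (λ xs → F xs + G xs)
addition = compose₂ {F = λ xs → lookup xs 0F + lookup xs 1F}
  (primitiveRecursion (projection 0F) (successor (projection 1F))
    (λ { (y ∷ []) → refl }) (λ { x (y ∷ []) → refl }))

multiplication : ∀ {n} {F G : Vec ℕ n → ℕ} → Computable F → Computable G → Computable (λ xs → F xs * G xs)
multiplication = compose₂ {F = λ xs → lookup xs 0F * lookup xs 1F}
  (primitiveRecursion (constant 0) (addition (projection 2F) (projection 1F))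
    (λ { (y ∷ []) → refl }) (λ { x (y ∷ []) → refl }))

-- F and G are explicit because inferring them would require inverting the polynomial pair.
pairing : ∀ {n} (F G : Vec ℕ n → ℕ) → Computable F → Computable G → Computable (λ xs → pair (F xs) (G xs))
pairing F G cF cG =
  addition {F = λ xs → (F xs + G xs) * (F xs + G xs)} {G = G}
    (multiplication {F = λ xs → F xs + G xs} {G = λ xs → F xs + G xs} (addition cF cG) (addition cF cG)) cG

tagged : ∀ {n} t (F G : Vec ℕ n → ℕ) → Computable F → Computable G →
  Computable (λ xs → pair t (pair (F xs) (G xs)))
tagged t F G cF cG = pairing (λ _ → t) (λ xs → pair (F xs) (G xs)) (constant t) (pairing F G cF cG)

downFrom-code : ∀ {n} {F : Vec ℕ n → ℕ} → Computable F → Computable (λ xs → codeL (downFrom (F xs)))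
downFrom-code = compose₁ {F = λ xs → codeL (downFrom (lookup xs 0F))}
  (primitiveRecursion {R = λ xs → codeL (downFrom (lookup xs 0F))}
    (constant 0)
    (successor (pairing (λ xs → lookup xs 0F) (λ xs → lookup xs 1F) (projection 0F) (projection 1F)))
    (λ { [] → refl }) (λ { _ [] → refl }))

prenex-code : ∀ {n} q (F : Vec ℕ n → ℕ) → Computable F →
  Computable (λ xs → pair (codeL (downFrom (suc (F xs)))) (pair q (F xs)))
prenex-code q F cF =
  pairing (λ xs → codeL (downFrom (suc (F xs)))) (λ xs → pair q (F xs))
    (downFrom-code (successor cF)) (pairing (λ _ → q) F (constant q) cF)

≈-code : ∀ {k n} (F G : Vec ℕ n → ℕ) → Computable F → Computable G →
  Computable (λ xs → codeF {k} (F xs ≈ G xs))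
≈-code = tagged 3

∧-code : ∀ {n} (F G : Vec ℕ n → ℕ) → Computable F → Computable G →
  Computable (λ xs → pair 5 (pair (F xs) (G xs)))
∧-code = tagged 5

pointsTo-code : ∀ {n k} (zs : Vec Var k) (F G : Vec ℕ n → ℕ) → Computable F → Computable G →
  Computable (λ xs → codeF ((F xs ↦ (G xs ∷ zs)) ⋆ tt))
pointsTo-code zs F G cF cG =
  tagged 7 (λ xs → codeF (F xs ↦ (G xs ∷ zs))) (λ _ → codeF {1} tt)
    (tagged 4 F (λ xs → codeL (G xs ∷ toList zs)) cF
      (successor {F = λ xs → pair (G xs) (codeL (toList zs))}
        (pairing G (λ _ → codeL (toList zs)) cG (constant (codeL (toList zs))))))
    (constant (codeF {1} tt))

square-≥ : ∀ n → n ≤ n * n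
square-≥ zero    = z≤n
square-≥ (suc n) = m≤m*n (suc n) (suc n)

pair-≥ˡ : ∀ a b → a ≤ pair a b
pair-≥ˡ a b = ≤-trans (m≤m+n a b) (≤-trans (square-≥ (a + b)) (m≤m+n _ b))

pair-≥ʳ : ∀ a b → b ≤ pair a b
pair-≥ʳ a b = m≤n+m b _

-- With s = a + b, `pair a b` lies between s * s and s * s + s, hence below the square of s + 1. The
-- code therefore determines the sum first, and then both components.
pair-< : ∀ a b c d → a + b < c + d → pair a b < pair c d
pair-< a b c d lt = begin-strict
  (a + b) * (a + b) + b             ≤⟨ +-monoʳ-≤ ((a + b) * (a + b)) (m≤n+m b a) ⟩
  (a + b) * (a + b) + (a + b)       ≡⟨ +-comm ((a + b) * (a + b)) (a + b) ⟩
  suc (a + b) * (a + b)             <⟨ *-monoʳ-< (suc (a + b)) (n<1+n (a + b)) ⟩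
  suc (a + b) * suc (a + b)         ≤⟨ *-mono-≤ lt lt ⟩
  (c + d) * (c + d)                 ≤⟨ m≤m+n _ d ⟩
  pair c d                          ∎
  where open ≤-Reasoning

pair-injective : ∀ {a b c d} → pair a b ≡ pair c d → a ≡ c × b ≡ d
pair-injective {a} {b} {c} {d} eq with <-cmp (a + b) (c + d)
... | tri< lt _ _ = contradiction eq (<⇒≢ (pair-< a b c d lt))
... | tri> _ _ gt = contradiction (sym eq) (<⇒≢ (pair-< c d a b gt))
... | tri≈ _ same _ = +-cancelʳ-≡ b a c (trans same (cong (c +_) (sym b≡d))) , b≡d
  where
  b≡d : b ≡ d
  b≡d = +-cancelˡ-≡ ((a + b) * (a + b)) b d (trans eq (cong (λ m → m * m + d) (sym same)))

-- Programs on trees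

data Tree : Set where
  leaf : ℕ → Tree
  node : Tree → Tree → Tree

-- Leaves are their own children: the child maps are total, and a finite heap can be closed under
-- them.
left right : Tree → Tree
left (leaf i)    = leaf i
left (node a b)  = a
right (leaf i)   = leaf i
right (node a b) = b

_≟ᵗ_ : DecidableEquality Tree
leaf i ≟ᵗ leaf j with i ≟ j
... | yes refl = yes refl
... | no  i≢j  = no λ { refl → i≢j refl }
leaf i ≟ᵗ node c d = no λ ()
node a b ≟ᵗ leaf j = no λ ()
node a b ≟ᵗ node c d with a ≟ᵗ c | b ≟ᵗ d
... | yes refl | yes refl = yes refl
... | no a≢c   | _        = no λ { refl → a≢c refl }
... | yes refl | no b≢d   = no λ { refl → b≢d refl }

codeᵗ : Tree → ℕ
codeᵗ (leaf i)   = pair 0 i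
codeᵗ (node a b) = pair (suc (codeᵗ a)) (codeᵗ b)

codeᵗ-injective : ∀ a b → codeᵗ a ≡ codeᵗ b → a ≡ b
codeᵗ-injective (leaf i)   (leaf j)   eq = cong leaf (proj₂ (pair-injective {0} {i} {0} {j} eq))
codeᵗ-injective (leaf i)   (node c d) eq with pair-injective {0} {i} {suc (codeᵗ c)} {codeᵗ d} eq
... | () , _
codeᵗ-injective (node a b) (leaf j)   eq with pair-injective {suc (codeᵗ a)} {codeᵗ b} {0} {j} eq
... | () , _
codeᵗ-injective (node a b) (node c d) eq
  with pair-injective {suc (codeᵗ a)} {codeᵗ b} {suc (codeᵗ c)} {codeᵗ d} eq
... | p , q = cong₂ node (codeᵗ-injective a c (suc-injective p)) (codeᵗ-injective b d q)

numeral : ℕ → Tree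
numeral zero    = leaf 0
numeral (suc n) = node (numeral n) (leaf 1)

tuple : ∀ {n} → Vec ℕ n → Tree
tuple []       = leaf 0
tuple (x ∷ xs) = node (numeral x) (tuple xs)

-- Unary combinators on trees replace functions of all arities, with argument vectors built by
-- `fork`, so that every judgement has one fixed shape with at most two premises.
data Prog : Set where
  nil id cons₁ hd tl : Prog
  fork comp rec      : Prog → Prog → Prog
  search             : Prog → Prog

-- Leaf labels: 0 is nil (and the number zero), 1 marks successors, 2 marks judgements, 3 to 11 are
-- program constructors.
⌜_⌝ : Prog → Tree
⌜ nil ⌝      = node (leaf 3) (leaf 0)
⌜ id ⌝       = node (leaf 4) (leaf 0)
⌜ cons₁ ⌝    = node (leaf 5) (leaf 0)
⌜ hd ⌝       = node (leaf 6) (leaf 0)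
⌜ tl ⌝       = node (leaf 7) (leaf 0)
⌜ fork p q ⌝ = node (leaf 8) (node ⌜ p ⌝ ⌜ q ⌝)
⌜ comp p q ⌝ = node (leaf 9) (node ⌜ p ⌝ ⌜ q ⌝)
⌜ rec p q ⌝  = node (leaf 10) (node ⌜ p ⌝ ⌜ q ⌝)
⌜ search p ⌝ = node (leaf 11) (node ⌜ p ⌝ (leaf 0))

data Eval : Prog → Tree → Tree → Set where
  nil     : ∀ {a} → Eval nil a (leaf 0)
  id      : ∀ {a} → Eval id a a
  cons₁   : ∀ {a} → Eval cons₁ a (node a (leaf 1))
  hd      : ∀ {a b} → Eval hd (node a b) a
  tl      : ∀ {a b} → Eval tl (node a b) b
  fork    : ∀ {p q a v w} → Eval p a v → Eval q a w → Eval (fork p q) a (node v w)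
  comp    : ∀ {p q a b v} → Eval q a b → Eval p b v → Eval (comp p q) a v
  rec0    : ∀ {p q xs v} → Eval p xs v → Eval (rec p q) (node (leaf 0) xs) v
  recS    : ∀ {p q n xs z v} → Eval (rec p q) (node n xs) z → Eval q (node n (node z xs)) v →
            Eval (rec p q) (node (node n (leaf 1)) xs) v
  search0 : ∀ {p z xs} → Eval p (node z xs) (leaf 0) → Eval (search p) (node z xs) z
  searchS : ∀ {p z xs w v} → Eval p (node z xs) (node w (leaf 1)) →
            Eval (search p) (node (node z (leaf 1)) xs) v → Eval (search p) (node z xs) v

compile-proj : ∀ {n} → Fin n → Prog
compile-proj zero    = hd
compile-proj (suc i) = comp (compile-proj i) tl

mutual
  compile : ∀ {n} → PR n → Prog
  compile zeroF       = nil
  compile succF       = comp cons₁ hd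
  compile (projF i)   = compile-proj i
  compile (compF f g) = comp (compile f) (compile* g)
  compile (recF f g)  = rec (compile f) (compile g)
  -- `fork nil id` prepends the candidate 0, from which `search` counts upwards.
  compile (muF f)     = comp (search (compile f)) (fork nil id)

  compile* : ∀ {m n} → Vec (PR n) m → Prog
  compile* []       = nil
  compile* (g ∷ gs) = fork (compile g) (compile* gs)

-- Induction on the distance `d` from the current candidate `z` to the least zero `y`.
search-from : ∀ {p t y} → Eval p (node (numeral y) t) (leaf 0) →
  (∀ z → z < y → Σ ℕ λ v → Eval p (node (numeral z) t) (numeral (suc v))) →
  ∀ d z → d + z ≡ y → Eval (search p) (node (numeral z) t) (numeral y)
search-from found below zero    z refl = search0 found
search-from found below (suc d) z refl =
  searchS (proj₂ (below z (s≤s (m≤n+m z d)))) (search-from found below d (suc z) (+-suc d z))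

eval-proj : ∀ {n} (i : Fin n) xs → Eval (compile-proj i) (tuple xs) (numeral (lookup xs i))
eval-proj zero    (x ∷ xs) = hd
eval-proj (suc i) (x ∷ xs) = comp tl (eval-proj i xs)

mutual
  eval-compile : ∀ {n} {f : PR n} {xs y} → f ∙ xs ⇓ y → Eval (compile f) (tuple xs) (numeral y)
  eval-compile zero⇓        = nil
  eval-compile succ⇓        = comp hd cons₁
  eval-compile (proj⇓ {i = i} {xs}) = eval-proj i xs
  eval-compile (comp⇓ d e)  = comp (eval-compile* d) (eval-compile e)
  eval-compile (rec0⇓ d)    = rec0 (eval-compile d)
  eval-compile (recS⇓ d e)  = recS (eval-compile d) (eval-compile e)
  eval-compile (mu⇓ {f = f} {xs} {y} d below) =
    comp (fork nil id) (search-from (eval-compile d) below′ y 0 (+-identityʳ y))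
    where
    below′ : ∀ z → z < y → Σ ℕ λ v → Eval (compile f) (node (numeral z) (tuple xs)) (numeral (suc v))
    below′ z z<y with below z z<y
    ... | v , e = v , eval-compile e

  eval-compile* : ∀ {m n} {gs : Vec (PR n) m} {xs ys} → gs ∙* xs ⇓ ys →
    Eval (compile* gs) (tuple xs) (tuple ys)
  eval-compile* []⇓       = nil
  eval-compile* (∷⇓ d ds) = fork (eval-compile d) (eval-compile* ds)

-- Stores and heaps

free-≤-codeL : ∀ {v} xs → v ∈ xs → v ≤ codeL xs
free-≤-codeL (x ∷ xs) (here refl) = m≤n⇒m≤1+n (pair-≥ˡ x (codeL xs))
free-≤-codeL (x ∷ xs) (there v∈)  =
  m≤n⇒m≤1+n (≤-trans (free-≤-codeL xs v∈) (pair-≥ʳ x (codeL xs)))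

free-≤-code : ∀ {k v} (φ : Formula k) → Free v φ → v ≤ codeF φ
free-≤-code {v = v} φ = go φ
  where
  snd : ∀ a b → v ≤ b → v ≤ pair a b
  snd a b v≤b = ≤-trans v≤b (pair-≥ʳ a b)
  fst : ∀ a b → v ≤ a → v ≤ pair a b
  fst a b v≤a = ≤-trans v≤a (pair-≥ˡ a b)
  go : ∀ {k} (φ : Formula k) → Free v φ → v ≤ codeF φ
  go (x ≈ y)  (inj₁ refl) = snd 3 _ (pair-≥ˡ x y)
  go (x ≈ y)  (inj₂ refl) = snd 3 _ (pair-≥ʳ x y)
  go (x ↦ ys) (inj₁ refl) = snd 4 _ (pair-≥ˡ x _)
  go (x ↦ ys) (inj₂ v∈)   = snd 4 _ (snd x _ (free-≤-codeL (toList ys) v∈))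
  go (φ ∧ ψ)  (inj₁ v∈)   = snd 5 _ (fst _ (codeF ψ) (go φ v∈))
  go (φ ∧ ψ)  (inj₂ v∈)   = snd 5 _ (snd (codeF φ) _ (go ψ v∈))
  go (¬ᶠ φ)   v∈          = snd 6 _ (go φ v∈)
  go (φ ⋆ ψ)  (inj₁ v∈)   = snd 7 _ (fst _ (codeF ψ) (go φ v∈))
  go (φ ⋆ ψ)  (inj₂ v∈)   = snd 7 _ (snd (codeF φ) _ (go ψ v∈))
  go (φ -⋆ ψ) (inj₁ v∈)   = snd 8 _ (fst _ (codeF ψ) (go φ v∈))
  go (φ -⋆ ψ) (inj₂ v∈)   = snd 8 _ (snd (codeF φ) _ (go ψ v∈))
  go (∃ᶠ x φ) (_ , v∈)    = snd 9 _ (snd x _ (go φ v∈))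

-- The code of a formula bounds its variables, so binding all variables up to the code closes it.
close : ∀ {k} → ℕ → (φ : Formula k) → IsQF φ → BSR k
close N φ qf = bsr (downFrom (suc (codeF φ))) (downFrom N) φ qf
  λ v v∈ → inj₁ (∈-downFrom⁺ (s≤s (free-≤-code φ v∈)))

-- The wand is vacuous exactly when no cell at `x` can be added disjointly, that is, when `x`
-- already owns one. The content `replicate k x` is arbitrary.
allocated : ∀ {k} → Var → Formula k
allocated {k} x = (x ↦ replicate k x) -⋆ ff

≡ᵇ-refl : ∀ x → (x ≡ᵇ x) ≡ true
≡ᵇ-refl zero    = refl
≡ᵇ-refl (suc x) = ≡ᵇ-refl x

≢⇒≡ᵇ-false : ∀ v x → v ≢ x → (v ≡ᵇ x) ≡ false
≢⇒≡ᵇ-false zero    zero    v≢x = contradiction refl v≢x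
≢⇒≡ᵇ-false zero    (suc x) _   = refl
≢⇒≡ᵇ-false (suc v) zero    _   = refl
≢⇒≡ᵇ-false (suc v) (suc x) v≢x = ≢⇒≡ᵇ-false v x λ { refl → v≢x refl }

module Stores (U : Set) {k : ℕ} where
  open Sem U {k}

  update-same : ∀ (s : Store U) x u → (s [ x ≔ u ]) x ≡ u
  update-same s x u rewrite ≡ᵇ-refl x = refl

  update-other : ∀ (s : Store U) {x} u {v} → v ≢ x → (s [ x ≔ u ]) v ≡ s v
  update-other s {x} u {v} v≢x rewrite ≢⇒≡ᵇ-false v x v≢x = refl

  update-cong : ∀ {s t : Store U} → s ≗ t → ∀ x u → (s [ x ≔ u ]) ≗ (t [ x ≔ u ])
  update-cong s≗t x u v with v ≡ᵇ x
  ... | true  = refl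
  ... | false = s≗t v

  vmap-cong : ∀ {n} {s t : Store U} (ys : Vec Var n) → (∀ v → v ∈ toList ys → s v ≡ t v) →
    vmap s ys ≡ vmap t ys
  vmap-cong []       eq = refl
  vmap-cong (y ∷ ys) eq = cong₂ _∷_ (eq y (here refl)) (vmap-cong ys λ v v∈ → eq v (there v∈))

  coincidence : ∀ φ {s t h} → IsQF φ → (∀ v → Free v φ → s v ≡ t v) → ⟦ φ ⟧ s h → ⟦ φ ⟧ t h
  coincidence tt       _         eq m = m
  coincidence emp      _         eq m = m
  coincidence (x ≈ y)  _         eq m = trans (sym (eq x (inj₁ refl))) (trans m (eq y (inj₂ refl)))
  coincidence (x ↦ ys) {h = h} _ eq (m , only) =
    trans (cong h (sym (eq x (inj₁ refl)))) (trans m (cong just (vmap-cong ys λ v v∈ → eq v (inj₂ v∈)))) ,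
    λ u u≢ → only u λ u≡ → u≢ (trans u≡ (eq x (inj₁ refl)))
  coincidence (φ ∧ ψ)  (qφ , qψ) eq (m , n) =
    coincidence φ qφ (λ v v∈ → eq v (inj₁ v∈)) m , coincidence ψ qψ (λ v v∈ → eq v (inj₂ v∈)) n
  coincidence (¬ᶠ φ)   q         eq m n = m (coincidence φ q (λ v v∈ → sym (eq v v∈)) n)
  coincidence (φ ⋆ ψ)  (qφ , qψ) eq (h₁ , h₂ , f₁ , f₂ , un , m , n) = h₁ , h₂ , f₁ , f₂ , un ,
    coincidence φ qφ (λ v v∈ → eq v (inj₁ v∈)) m , coincidence ψ qψ (λ v v∈ → eq v (inj₂ v∈)) n
  coincidence (φ -⋆ ψ) (qφ , qψ) eq m h′ h″ f un n =
    coincidence ψ qψ (λ v v∈ → eq v (inj₂ v∈))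
      (m h′ h″ f un (coincidence φ qφ (λ v v∈ → sym (eq v (inj₁ v∈))) n))

  Extensional : (Store U → Set) → Set
  Extensional P = ∀ {s t} → s ≗ t → P s → P t

  formula-extensional : ∀ {φ h} → IsQF φ → Extensional (λ s → ⟦ φ ⟧ s h)
  formula-extensional {φ} q eq = coincidence φ q λ v _ → eq v

  alls-extensional : ∀ {P} → Extensional P → ∀ xs → Extensional (Alls xs P)
  alls-extensional ext []       eq m   = ext eq m
  alls-extensional ext (x ∷ xs) eq m u = alls-extensional ext xs (update-cong eq x u) (m u)

  -- The prefix quantifies every variable below `N`, so it can be instantiated by a whole store `t`
  -- at once: each step picks the value that `t` prescribes.
  alls-elim : ∀ {P} → Extensional P → ∀ N {s t} → (∀ v → N ≤ v → t v ≡ s v) →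
    Alls (downFrom N) P s → P t
  alls-elim ext zero    eq m = ext (λ v → sym (eq v z≤n)) m
  alls-elim ext (suc N) {s} {t} eq m = alls-elim ext N eq′ (m (t N))
    where
    eq′ : ∀ v → N ≤ v → t v ≡ (s [ N ≔ t N ]) v
    eq′ v N≤v with v ≟ N
    ... | yes refl = sym (update-same s N (t N))
    ... | no  v≢N  = trans (eq v (≤∧≢⇒< N≤v (≢-sym v≢N))) (sym (update-other s (t N) v≢N))

  alls-intro : ∀ {P} N {s} → (∀ t → (∀ v → N ≤ v → t v ≡ s v) → P t) → Alls (downFrom N) P s
  alls-intro zero    m = m _ λ _ _ → refl
  alls-intro (suc N) {s} m u = alls-intro N λ t eq → m t λ v N<v →
    trans (eq v (<⇒≤ N<v)) (update-other s u λ { refl → <-irrefl refl N<v })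

  exs-elim : ∀ {P} xs {s} → Exs xs P s → Σ (Store U) P
  exs-elim []       m       = _ , m
  exs-elim (x ∷ xs) (u , m) = exs-elim xs m

  -- Each existential variable receives the value it has in `s`, so all updates along the way end in
  -- a store pointwise equal to `s`.
  exs-intro : ∀ {P} → Extensional P → ∀ xs {s} → P s → Exs xs P s
  exs-intro {P} ext xs {s} m = go xs λ _ → refl
    where
    go : ∀ xs {t} → t ≗ s → Exs xs P t
    go []       eq = ext (λ v → sym (eq v)) m
    go (x ∷ xs) {t} eq = s x , go xs eq′
      where
      eq′ : (t [ x ≔ s x ]) ≗ s
      eq′ v with v ≟ x
      ... | yes refl = update-same t x (s x)
      ... | no  v≢x  = trans (update-other t (s x) v≢x) (eq v)

  prenex-elim : ∀ φ → IsQF φ → ∀ N {s t h} → (∀ v → N ≤ v → t v ≡ s v) →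
    Alls (downFrom N) (λ t → ⟦ φ ⟧ t h) s → ⟦ φ ⟧ t h
  prenex-elim φ q N {h = h} = alls-elim (formula-extensional {φ} {h} q) N

  prenex-intro : ∀ φ → IsQF φ → ∀ N {s h} → (∀ t → (∀ v → N ≤ v → t v ≡ s v) → ⟦ φ ⟧ t h) →
    ∀ E → Exs E (Alls (downFrom N) (λ t → ⟦ φ ⟧ t h)) s
  prenex-intro φ q N {h = h} m E =
    exs-intro (alls-extensional (formula-extensional {φ} {h} q) (downFrom N)) E (alls-intro N m)

module Heaps (U : Set) (_≟ᵁ_ : DecidableEquality U) {k : ℕ} where
  open Sem U {k}

  singleton : U → Vec U k → Heap U k
  singleton x w u with u ≟ᵁ x
  ... | yes _ = just w
  ... | no  _ = nothing

  singleton-at : ∀ x w → singleton x w x ≡ just w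
  singleton-at x w with x ≟ᵁ x
  ... | yes _  = refl
  ... | no x≢x = contradiction refl x≢x

  singleton-off : ∀ x w u → u ≢ x → singleton x w u ≡ nothing
  singleton-off x w u u≢x with u ≟ᵁ x
  ... | yes u≡x = contradiction u≡x u≢x
  ... | no  _   = refl

  singleton-finite : ∀ x w → FinDom (singleton x w)
  singleton-finite x w = x ∷ [] , covers
    where
    covers : ∀ u v → singleton x w u ≡ just v → u ∈ x ∷ []
    covers u v eq with u ≟ᵁ x
    covers u v eq | yes u≡x = here u≡x
    covers u v () | no _

  without : U → Heap U k → Heap U k
  without x h u with u ≟ᵁ x
  ... | yes _ = nothing
  ... | no  _ = h u

  without-finite : ∀ x {h} → FinDom h → FinDom (without x h)
  without-finite x {h} (L , cover) = L , covers
    where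
    covers : ∀ u v → without x h u ≡ just v → u ∈ L
    covers u v eq with u ≟ᵁ x
    covers u v () | yes _
    covers u v eq | no _ = cover u v eq

  pointsTo-intro : ∀ {x ys s h} → FinDom h → h (s x) ≡ just (vmap s ys) → ⟦ (x ↦ ys) ⋆ tt ⟧ s h
  pointsTo-intro {x} {ys} {s} {h} fin eq =
    singleton (s x) (vmap s ys) , without (s x) h , singleton-finite _ _ , without-finite _ fin ,
    union , (singleton-at _ _ , singleton-off _ _) , tt
    where
    union : Union h (singleton (s x) (vmap s ys)) (without (s x) h)
    union u with u ≟ᵁ s x
    ... | yes refl = inj₂ (refl , eq)
    ... | no  _    = inj₁ (refl , refl)

  pointsTo-elim : ∀ {x ys s h} → ⟦ (x ↦ ys) ⋆ tt ⟧ s h → h (s x) ≡ just (vmap s ys)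
  pointsTo-elim {x} {s = s} (h₁ , h₂ , _ , _ , union , (eq , _) , _) with union (s x)
  ... | inj₁ (none , _) = contradiction (trans (sym none) eq) λ ()
  ... | inj₂ (_ , same) = trans same eq

  allocated-intro : ∀ {x s h w} → h (s x) ≡ just w → ⟦ allocated x ⟧ s h
  allocated-intro {x} {s} eq h′ h″ _ union (at , _) with union (s x)
  ... | inj₁ (none , _) = contradiction (trans (sym none) eq) λ ()
  ... | inj₂ (none , _) = contradiction (trans (sym none) at) λ ()

  not-allocated : ∀ {x s h} → h (s x) ≡ nothing → ¬ ⟦ allocated x ⟧ s h
  not-allocated {x} {s} {h} none m =
    m (singleton (s x) w) h″ (singleton-finite _ _) union (singleton-at _ _ , singleton-off _ _)
    where
    w : Vec U k
    w = vmap s (replicate k x)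
    h″ : Heap U k
    h″ u with u ≟ᵁ s x
    ... | yes _ = just w
    ... | no  _ = h u
    union : Union h″ h (singleton (s x) w)
    union u with u ≟ᵁ s x
    ... | yes refl = inj₁ (none , refl)
    ... | no  _    = inj₂ (refl , refl)

-- Local rules for derivation trees

-- # i is a universally quantified variable of the sentence, κ i an existential one that names leaf i.
data Term : Set where
  # : ℕ → Term
  κ : Fin 3 → Term

Equations : Set
Equations = List (Term × Term)

module _ {A : Set} where

  infixr 5 _▹_
  _▹_ : List A → (ℕ → A) → ℕ → A
  ([]       ▹ σ) i       = σ i
  ((x ∷ xs) ▹ σ) zero    = x
  ((x ∷ xs) ▹ σ) (suc i) = (xs ▹ (λ j → σ (suc j))) i

  ▹-beyond : ∀ xs σ i → length xs ≤ i → (xs ▹ σ) i ≡ σ i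
  ▹-beyond []       σ i       _         = refl
  ▹-beyond (x ∷ xs) σ (suc i) (s≤s len) = ▹-beyond xs (λ j → σ (suc j)) i len

  tabulate-▹ : ∀ {n} (xs : Vec A n) σ → tabulate (λ i → (toList xs ▹ σ) (toℕ i)) ≡ xs
  tabulate-▹ []       σ = refl
  tabulate-▹ (x ∷ xs) σ = cong (x ∷_) (tabulate-▹ xs (λ j → σ (suc j)))

  value : (ℕ → A) → (ℕ → A) → Term → A
  value ν γ (# i) = ν i
  value ν γ (κ i) = γ (toℕ i)

  Solves : (ℕ → A) → (ℕ → A) → Equations → Set
  Solves ν γ []             = ⊤
  Solves ν γ ((x , y) ∷ es) = value ν γ x ≡ value ν γ y × Solves ν γ es

  module _ (l r : A → A) where

    Links : (ℕ → A) → ℕ → List ℕ → Set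
    Links τ m []       = ⊤
    Links τ m (p ∷ ps) = (τ m ≡ l (τ p) × τ (suc m) ≡ r (τ p)) × Links τ (2 + m) ps

Ordered : ℕ → List ℕ → Set
Ordered m []       = ⊤
Ordered m (p ∷ ps) = p < m × Ordered (2 + m) ps

ordered? : ∀ m ps → Dec (Ordered m ps)
ordered? m []       = yes tt
ordered? m (p ∷ ps) = (p <? m) ×-dec ordered? (2 + m) ps

below-two : ∀ {m} (P : ℕ → Set) → (∀ v → v < m → P v) → P m → P (suc m) → ∀ v → v < 2 + m → P v
below-two {m} P below at-m at-m′ v v< with m≤n⇒m<n∨m≡n (s≤s⁻¹ v<)
... | inj₂ refl = at-m′
... | inj₁ v<m′ with m≤n⇒m<n∨m≡n (s≤s⁻¹ v<m′)
...   | inj₂ refl = at-m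
...   | inj₁ v<m  = below v v<m

-- By `Ordered`, every parent is numbered before its children, so agreement at the start propagates
-- through all links. This identifies a store that reads the cells of an unfolding with `unfold`
-- itself.
links-unique : ∀ {A : Set} {l r : A → A} {τ ν} m ps → Ordered m ps → Links l r τ m ps → Links l r ν m ps →
  (∀ v → v < m → τ v ≡ ν v) → ∀ v → v < length ps * 2 + m → τ v ≡ ν v
links-unique m []       _           _                _                eq v v< = eq v v<
links-unique {l = l} {r} {τ} {ν} m (p ∷ ps) (p<m , ord) ((a , b) , lτ) ((c , d) , lν) eq v v< =
  links-unique (2 + m) ps ord lτ lν
    (below-two (λ v → τ v ≡ ν v) eq (trans a (trans (cong l (eq p p<m)) (sym c)))
                                    (trans b (trans (cong r (eq p p<m)) (sym d))))
    v (subst (v <_) (sym (trans (+-suc (length ps * 2) (suc m)) (cong suc (+-suc (length ps * 2) m)))) v<)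

-- A judgement node c = (J , ((program , argument) , (result , (s₁ , s₂)))) has the judgements s₁ and s₂
-- as premises. Universal variable 0 stands for c, and the j-th entry of this list is the variable whose
-- two children are called 2j+1 and 2j+2.
parents : List ℕ
parents = 0 ∷ 2 ∷ 3 ∷ 4 ∷ 8 ∷ 5 ∷ 12 ∷ 6 ∷ 15 ∷ 7 ∷ 9 ∷ 22 ∷ 23 ∷ 24 ∷ 26 ∷ 27 ∷ 10 ∷ 34 ∷ 35 ∷ 36 ∷
  38 ∷ 41 ∷ 42 ∷ []

-- Spelled out rather than computed from `parents`, so that every link holds by `refl`. The 47
-- entries are the root and two children for each of the 23 parents.
unfold : {A : Set} → (A → A) → (A → A) → (ℕ → A) → A → ℕ → A
unfold l r σ c =
  (c ∷ l c ∷ r c ∷ l (r c) ∷ r (r c) ∷ l (l (r c)) ∷ r (l (r c)) ∷ l (r (r c)) ∷ r (r (r c)) ∷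
  l (r (r (r c))) ∷ r (r (r (r c))) ∷ l (l (l (r c))) ∷ r (l (l (r c))) ∷ l (r (l (l (r c)))) ∷
  r (r (l (l (r c)))) ∷ l (r (l (r c))) ∷ r (r (l (r c))) ∷ l (l (r (l (r c)))) ∷
  r (l (r (l (r c)))) ∷ l (l (r (r c))) ∷ r (l (r (r c))) ∷ l (l (r (r (r c)))) ∷
  r (l (r (r (r c)))) ∷ l (r (l (r (r (r c))))) ∷ r (r (l (r (r (r c))))) ∷
  l (l (r (l (r (r (r c)))))) ∷ r (l (r (l (r (r (r c)))))) ∷ l (r (r (l (r (r (r c)))))) ∷
  r (r (r (l (r (r (r c)))))) ∷ l (r (l (r (l (r (r (r c))))))) ∷ r (r (l (r (l (r (r (r c))))))) ∷
  l (l (r (r (l (r (r (r c))))))) ∷ r (l (r (r (l (r (r (r c))))))) ∷ l (r (r (r (r c)))) ∷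
  r (r (r (r (r c)))) ∷ l (r (r (r (r (r c))))) ∷ r (r (r (r (r (r c))))) ∷
  l (l (r (r (r (r (r c)))))) ∷ r (l (r (r (r (r (r c)))))) ∷ l (r (r (r (r (r (r c)))))) ∷
  r (r (r (r (r (r (r c)))))) ∷ l (r (l (r (r (r (r (r c))))))) ∷ r (r (l (r (r (r (r (r c))))))) ∷
  l (l (r (l (r (r (r (r (r c)))))))) ∷ r (l (r (l (r (r (r (r (r c)))))))) ∷
  l (r (r (l (r (r (r (r (r c)))))))) ∷ r (r (r (l (r (r (r (r (r c)))))))) ∷ []) ▹ σ

parents-ordered : Ordered 1 parents
parents-ordered = from-yes (ordered? 1 parents)

unfold-links : ∀ {A : Set} (l r : A → A) σ c → Links l r (unfold l r σ c) 1 parents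
unfold-links l r σ c =
  (refl , refl) , (refl , refl) , (refl , refl) , (refl , refl) , (refl , refl) , (refl , refl) ,
  (refl , refl) , (refl , refl) , (refl , refl) , (refl , refl) , (refl , refl) , (refl , refl) ,
  (refl , refl) , (refl , refl) , (refl , refl) , (refl , refl) , (refl , refl) , (refl , refl) ,
  (refl , refl) , (refl , refl) , (refl , refl) , (refl , refl) , (refl , refl) , tt

unfold-beyond : ∀ {A : Set} (l r : A → A) σ c v → 47 ≤ v → unfold l r σ c v ≡ σ v
unfold-beyond l r σ c v = ▹-beyond _ σ v

nil# one# judge# : Term
nil#   = κ 0F
one#   = κ 1F
judge# = κ 2F

-- Names for positions in `unfold`. `p₁` and `p₂` are the two subprograms of `prog`; in the other
-- names below, a subscript selects a premise and the superscripts descend to children.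
mark prog arg res tag p₁ p₂ argˡ argʳ argˡˡ argˡʳ resˡ resʳ : Term
mark  = # 1
prog  = # 5
arg   = # 6
res   = # 7
tag   = # 11
p₁    = # 13
p₂    = # 14
argˡ  = # 15
argʳ  = # 16
argˡˡ = # 17
argˡʳ = # 18
resˡ  = # 19
resʳ  = # 20

mark₁ prog₁ arg₁ res₁ arg₁ˡ arg₁ʳ res₁ʳ : Term
mark₁ = # 21
prog₁ = # 25
arg₁  = # 26
res₁  = # 27
arg₁ˡ = # 29
arg₁ʳ = # 30
res₁ʳ = # 32

mark₂ prog₂ arg₂ res₂ arg₂ˡ arg₂ʳ arg₂ˡˡ arg₂ˡʳ arg₂ʳˡ arg₂ʳʳ : Term
mark₂  = # 33
prog₂  = # 37
arg₂   = # 38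
res₂   = # 39
arg₂ˡ  = # 41
arg₂ʳ  = # 42
arg₂ˡˡ = # 43
arg₂ˡʳ = # 44
arg₂ʳˡ = # 45
arg₂ʳʳ = # 46

Rule : Set
Rule = Equations × Equations

-- Indexed by the label of the program constructor; the right-hand equations follow from the left-hand ones.
rules : ℕ → List Rule
rules 3  = ([] , (res , nil#) ∷ []) ∷ []
rules 4  = ([] , (res , arg) ∷ []) ∷ []
rules 5  = ([] , (resˡ , arg) ∷ (resʳ , one#) ∷ []) ∷ []
rules 6  = ([] , (res , argˡ) ∷ []) ∷ []
rules 7  = ([] , (res , argʳ) ∷ []) ∷ []
rules 8  = ([] , (mark₁ , judge#) ∷ (prog₁ , p₁) ∷ (arg₁ , arg) ∷ (resˡ , res₁) ∷
                 (mark₂ , judge#) ∷ (prog₂ , p₂) ∷ (arg₂ , arg) ∷ (resʳ , res₂) ∷ []) ∷ []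
rules 9  = ([] , (mark₁ , judge#) ∷ (prog₁ , p₂) ∷ (arg₁ , arg) ∷
                 (mark₂ , judge#) ∷ (prog₂ , p₁) ∷ (arg₂ , res₁) ∷ (res , res₂) ∷ []) ∷ []
rules 10 = ((argˡ , nil#) ∷ [] ,
             (mark₁ , judge#) ∷ (prog₁ , p₁) ∷ (arg₁ , argʳ) ∷ (res , res₁) ∷ []) ∷
           ((argˡʳ , one#) ∷ [] ,
             (mark₁ , judge#) ∷ (prog₁ , prog) ∷ (arg₁ˡ , argˡˡ) ∷ (arg₁ʳ , argʳ) ∷
             (mark₂ , judge#) ∷ (prog₂ , p₂) ∷ (arg₂ˡ , argˡˡ) ∷ (arg₂ʳˡ , res₁) ∷ (arg₂ʳʳ , argʳ) ∷
             (res , res₂) ∷ []) ∷ []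
rules 11 = ([] , (mark₁ , judge#) ∷ (prog₁ , p₁) ∷ (arg₁ , arg) ∷ []) ∷
           ((res₁ , nil#) ∷ [] , (res , argˡ) ∷ []) ∷
           ((res₁ʳ , one#) ∷ [] ,
             (mark₂ , judge#) ∷ (prog₂ , prog) ∷ (arg₂ˡˡ , argˡ) ∷ (arg₂ˡʳ , one#) ∷ (arg₂ʳ , argʳ) ∷
             (res , res₂) ∷ []) ∷ []
rules _  = []

Obeys : {A : Set} → (ℕ → A) → (ℕ → A) → Rule → Set
Obeys ν γ (es , fs) = Solves ν γ es → Solves ν γ fs

Lawful : {A : Set} → (ℕ → A) → (ℕ → A) → Set
Lawful ν γ = ν 1 ≡ γ 2 → ∀ i → ν 11 ≡ γ i → All (Obeys ν γ) (rules i)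

-- The preorder matters: `describe` numbers its variables by it, with the left child of position b
-- at b + 1 and the right child after the whole left subtree.
subtrees : Tree → List Tree
subtrees (leaf i)   = leaf i ∷ []
subtrees (node a b) = node a b ∷ subtrees a ++ subtrees b

size : Tree → ℕ
size t = length (subtrees t)

Labels : (ℕ → Set) → Tree → Set
Labels P (leaf i)   = P i
Labels P (node a b) = Labels P a × Labels P b

-- Serves two purposes: avoiding 2 keeps program code from looking like a judgement, and staying
-- below 12 keeps it clear of the placeholders 12 and 13 in `claim`.
prog-labels : ∀ {P : ℕ → Set} → (∀ i → i < 12 → i ≢ 2 → P i) → ∀ p → Labels P ⌜ p ⌝
prog-labels {P} ok = go
  where
  ok′ : ∀ i d → suc i + d ≡ 12 → i ≢ 2 → P i
  ok′ i d eq = ok i (subst (suc i ≤_) eq (m≤m+n (suc i) d))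
  nil₀ : P 0
  nil₀ = ok′ 0 11 refl λ ()
  go : ∀ p → Labels P ⌜ p ⌝
  go nil        = ok′ 3 8 refl (λ ()) , nil₀
  go id         = ok′ 4 7 refl (λ ()) , nil₀
  go cons₁      = ok′ 5 6 refl (λ ()) , nil₀
  go hd         = ok′ 6 5 refl (λ ()) , nil₀
  go tl         = ok′ 7 4 refl (λ ()) , nil₀
  go (fork p q) = ok′ 8 3 refl (λ ()) , go p , go q
  go (comp p q) = ok′ 9 2 refl (λ ()) , go p , go q
  go (rec p q)  = ok′ 10 1 refl (λ ()) , go p , go q
  go (search p) = ok′ 11 0 refl (λ ()) , go p , nil₀

-- Derivation trees that obey the local rules

LawfulAt : Tree → Set
LawfulAt c = ∀ σ → Lawful (unfold left right σ c) leaf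

Good : Tree → Set
Good (leaf i)   = ⊤
Good (node a b) = LawfulAt (node a b) × Good a × Good b

-- Leaves are their own children, so a leaf marked as a judgement has itself as its tag, which no rule has.
lawful-leaf : ∀ j → LawfulAt (leaf j)
lawful-leaf j σ refl i refl = []

lawful-unmarked : ∀ {a b} → a ≢ leaf 2 → LawfulAt (node a b)
lawful-unmarked a≢ σ a≡ = contradiction a≡ a≢

-- A node is constrained only if its left child is `leaf 2`. Data without that label can be stored
-- inside a derivation tree at no obligation.
Plain : Tree → Set
Plain = Labels (_≢ 2)

plain-≢ : ∀ {a} → Plain a → a ≢ leaf 2
plain-≢ i≢2 refl = i≢2 refl

plain-good : ∀ a → Plain a → Good a
plain-good (leaf i)   _         = tt
plain-good (node a b) (pa , pb) = lawful-unmarked (plain-≢ pa) , plain-good a pa , plain-good b pb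

plain-prog : ∀ p → Plain ⌜ p ⌝
plain-prog = prog-labels λ _ _ i≢2 → i≢2

plain-numeral : ∀ n → Plain (numeral n)
plain-numeral zero    = λ ()
plain-numeral (suc n) = plain-numeral n , λ ()

judgement : Prog → Tree → Tree → Tree → Tree → Tree
judgement p a v s₁ s₂ = node (leaf 2) (node (node ⌜ p ⌝ a) (node v (node s₁ s₂)))

-- Apart from the root, the new nodes only pair up the components, and none has `leaf 2` on its
-- left; for the pair of premises this is the last hypothesis.
good-judgement : ∀ p {a v s₁ s₂} → LawfulAt (judgement p a v s₁ s₂) → Plain a → Plain v →
  Good s₁ → Good s₂ → s₁ ≢ leaf 2 → Good (judgement p a v s₁ s₂)
good-judgement p {a} {v} law pa pv g₁ g₂ s₁≢ =
  law , tt , lawful-unmarked (λ ()) ,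
  (lawful-unmarked (plain-≢ (plain-prog p)) , plain-good ⌜ p ⌝ (plain-prog p) , plain-good a pa) ,
  lawful-unmarked (plain-≢ pv) , plain-good v pv ,
  lawful-unmarked s₁≢ , g₁ , g₂

record Derivation (p : Prog) (a v : Tree) : Set where
  constructor derivation
  field
    s₁ s₂ : Tree
    good  : Good (judgement p a v s₁ s₂)

  tree : Tree
  tree = judgement p a v s₁ s₂

open Derivation using (tree; good)

-- The tree mirrors the evaluation, with `leaf 0` in place of absent premises. On such concrete
-- nodes `unfold` computes, so conclusions of rules are `refl`. Plainness of the result is carried
-- along because results become arguments of later premises.
derive : ∀ {p a v} → Eval p a v → Plain a → Derivation p a v × Plain v
derive nil pa = derivation (leaf 0) (leaf 0) (good-judgement nil
  (λ { σ _ i refl → (λ _ → refl , tt) ∷ [] })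
  pa (λ ()) tt tt λ ()) , λ ()
derive id pa = derivation (leaf 0) (leaf 0) (good-judgement id
  (λ { σ _ i refl → (λ _ → refl , tt) ∷ [] })
  pa pa tt tt λ ()) , pa
derive cons₁ pa = derivation (leaf 0) (leaf 0) (good-judgement cons₁
  (λ { σ _ i refl → (λ _ → refl , refl , tt) ∷ [] })
  pa (pa , λ ()) tt tt λ ()) , pa , λ ()
derive hd pa = derivation (leaf 0) (leaf 0) (good-judgement hd
  (λ { σ _ i refl → (λ _ → refl , tt) ∷ [] })
  pa (proj₁ pa) tt tt λ ()) , proj₁ pa
derive tl pa = derivation (leaf 0) (leaf 0) (good-judgement tl
  (λ { σ _ i refl → (λ _ → refl , tt) ∷ [] })
  pa (proj₂ pa) tt tt λ ()) , proj₂ pa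
derive (fork {p} {q} {a} {v} {w} d e) pa with derive d pa | derive e pa
... | D , pv | E , pw = derivation (tree D) (tree E) (good-judgement (fork p q)
  (λ { σ _ i refl → (λ _ → refl , refl , refl , refl , refl , refl , refl , refl , tt) ∷ [] })
  pa (pv , pw) (good D) (good E) λ ()) , pv , pw
derive (comp {p} {q} d e) pa with derive d pa
... | D , pb with derive e pb
...   | E , pv = derivation (tree D) (tree E) (good-judgement (comp p q)
  (λ { σ _ i refl → (λ _ → refl , refl , refl , refl , refl , refl , refl , tt) ∷ [] })
  pa pv (good D) (good E) λ ()) , pv
derive (rec0 {p} {q} d) pa with derive d (proj₂ pa)
... | D , pv = derivation (tree D) (leaf 0) (good-judgement (rec p q)
  -- The successor rule tests whether the right child of the counter is `leaf 1`; the counter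
  -- `leaf 0` is its own right child and fails the test.
  (λ { σ _ i refl → (λ _ → refl , refl , refl , refl , tt) ∷ (λ { (() , _) }) ∷ [] })
  pa pv (good D) tt λ ()) , pv
derive (recS {p} {q} d e) ((pn , po) , px) with derive d (pn , px)
... | D , pz with derive e (pn , pz , px)
...   | E , pv = derivation (tree D) (tree E) (good-judgement (rec p q)
  (λ { σ _ i refl → (λ { (() , _) }) ∷
       (λ _ → refl , refl , refl , refl , refl , refl , refl , refl , refl , refl , tt) ∷ [] })
  ((pn , po) , px) pv (good D) (good E) λ ()) , pv
derive (search0 {p} d) pa with derive d pa
... | D , _ = derivation (tree D) (leaf 0) (good-judgement (search p)
  (λ { σ _ i refl → (λ _ → refl , refl , refl , tt) ∷ (λ _ → refl , tt) ∷ (λ { (() , _) }) ∷ [] })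
  pa (proj₁ pa) (good D) tt λ ()) , proj₁ pa
derive (searchS {p} d e) (pz , px) with derive d (pz , px) | derive e ((pz , λ ()) , px)
... | D , _ | E , pv = derivation (tree D) (tree E) (good-judgement (search p)
  (λ { σ _ i refl → (λ _ → refl , refl , refl , tt) ∷ (λ { (() , _) }) ∷
       (λ _ → refl , refl , refl , refl , refl , refl , tt) ∷ [] })
  (pz , px) pv (good D) (good E) λ ()) , pv

-- Subtrees and universes made of trees

open import Data.List.Membership.DecPropositional _≟ᵗ_ using (_∈?_)

subtrees-self : ∀ t → t ∈ subtrees t
subtrees-self (leaf i)   = here refl
subtrees-self (node a b) = here refl

subtrees-trans : ∀ {s t} u → s ∈ subtrees t → t ∈ subtrees u → s ∈ subtrees u
subtrees-trans (leaf i)   s∈ (here refl) = s∈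
subtrees-trans (node a b) s∈ (here refl) = s∈
subtrees-trans (node a b) s∈ (there t∈) with ∈-++⁻ (subtrees a) t∈
... | inj₁ t∈a = there (∈-++⁺ˡ (subtrees-trans a s∈ t∈a))
... | inj₂ t∈b = there (∈-++⁺ʳ (subtrees a) (subtrees-trans b s∈ t∈b))

left-∈ : ∀ t → left t ∈ subtrees t
left-∈ (leaf i)   = here refl
left-∈ (node a b) = there (∈-++⁺ˡ (subtrees-self a))

right-∈ : ∀ t → right t ∈ subtrees t
right-∈ (leaf i)   = here refl
right-∈ (node a b) = there (∈-++⁺ʳ (subtrees a) (subtrees-self b))

good-lawful : ∀ {t} u → Good u → t ∈ subtrees u → LawfulAt t
good-lawful (leaf i)   _             (here refl) = lawful-leaf i
good-lawful (node a b) (law , _ , _) (here refl) = law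
good-lawful (node a b) (_ , ga , gb) (there t∈) with ∈-++⁻ (subtrees a) t∈
... | inj₁ t∈a = good-lawful a ga t∈a
... | inj₂ t∈b = good-lawful b gb t∈b

-- Each leaf is a right child, so that no new node looks like a judgement.
withLeaves : ℕ → Tree → Tree
withLeaves zero    t = t
withLeaves (suc i) t = node (withLeaves i t) (leaf i)

module _ {a b : Tree} where

  withLeaves-≢ : ∀ j i → withLeaves j (node a b) ≢ leaf i
  withLeaves-≢ zero    i ()
  withLeaves-≢ (suc j) i ()

  withLeaves-good : ∀ j → Good (node a b) → Good (withLeaves j (node a b))
  withLeaves-good zero    g = g
  withLeaves-good (suc j) g = lawful-unmarked (withLeaves-≢ j 2) , withLeaves-good j g , tt

withLeaves-self : ∀ j t → t ∈ subtrees (withLeaves j t)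
withLeaves-self zero    t = subtrees-self t
withLeaves-self (suc j) t = there (∈-++⁺ˡ (withLeaves-self j t))

withLeaves-leaf : ∀ j t i → i < j → leaf i ∈ subtrees (withLeaves j t)
withLeaves-leaf (suc j) t i i<j with m≤n⇒m<n∨m≡n (s≤s⁻¹ i<j)
... | inj₁ i<j′ = there (∈-++⁺ˡ (withLeaves-leaf j t i i<j′))
... | inj₂ refl = there (∈-++⁺ʳ (subtrees (withLeaves j t)) (here refl))

fill : (ℕ → Tree) → Tree → Tree
fill e (leaf i)   = e i
fill e (node a b) = node (fill e a) (fill e b)

fill-labels : ∀ {e} t → Labels (λ i → e i ≡ leaf i) t → fill e t ≡ t
fill-labels (leaf i)   eq        = eq
fill-labels (node a b) (ea , eb) = cong₂ node (fill-labels a ea) (fill-labels b eb)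

fill-∈ : ∀ {e s} t → s ∈ subtrees t → fill e s ∈ subtrees (fill e t)
fill-∈ {e} (leaf i)   (here refl) = subtrees-self (e i)
fill-∈ {e} (node a b) (here refl) = here refl
fill-∈ {e} (node a b) (there s∈) with ∈-++⁻ (subtrees a) s∈
... | inj₁ s∈a = there (∈-++⁺ˡ (fill-∈ a s∈a))
... | inj₂ s∈b = there (∈-++⁺ʳ (subtrees (fill e a)) (fill-∈ b s∈b))

-- Intended values of consecutively numbered variables; `leaf 0` is a harmless default past the end,
-- since it always lies in the heap.
entry : (ℕ → Tree) → List Tree → ℕ → Tree
entry e ts = map (fill e) ts ▹ λ _ → leaf 0

entry-++ : ∀ {e} ts us i → entry e (ts ++ us) (length ts + i) ≡ entry e us i
entry-++ []       us i = refl
entry-++ (t ∷ ts) us i = entry-++ ts us i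

entry-root : ∀ {e} t us → entry e (subtrees t ++ us) 0 ≡ fill e t
entry-root (leaf i)   us = refl
entry-root (node a b) us = refl

entry-∈ : ∀ {e b} ts i → leaf 0 ∈ subtrees b → (∀ {t} → t ∈ ts → fill e t ∈ subtrees b) →
  entry e ts i ∈ subtrees b
entry-∈ []       i       z∈ all = z∈
entry-∈ (t ∷ ts) zero    z∈ all = all (here refl)
entry-∈ (t ∷ ts) (suc i) z∈ all = entry-∈ ts i z∈ λ t∈ → all (there t∈)

-- A Boolean predicate has unique proofs, so elements are equal as soon as their trees are. Proofs
-- of membership in a list of subtrees would not be unique, because subtrees repeat.
Elements : (Tree → Bool) → Set
Elements isElement = Σ Tree λ t → T (isElement t)

U-≡ : ∀ {isElement} {u v : Elements isElement} → proj₁ u ≡ proj₁ v → u ≡ v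
U-≡ {u = t , a} {.t , b} refl = cong (t ,_) (T-irrelevant a b)

module _ (isElement : Tree → Bool) {us : List Tree} (element : ∀ {t} → t ∈ us → T (isElement t)) where

  elements : (ts : List Tree) → (∀ {t} → t ∈ ts → t ∈ us) → List (Elements isElement)
  elements []       sub = []
  elements (t ∷ ts) sub = (t , element (sub (here refl))) ∷ elements ts (λ t∈ → sub (there t∈))

  elements-∈ : ∀ u ts (sub : ∀ {t} → t ∈ ts → t ∈ us) → proj₁ u ∈ ts → u ∈ elements ts sub
  elements-∈ u (t ∷ ts) sub (here eq)  = here (U-≡ eq)
  elements-∈ u (t ∷ ts) sub (there t∈) = there (elements-∈ u ts (λ t∈ → sub (there t∈)) t∈)

if-< : ∀ {A : Set} {v m} {x y : A} → v < m → (if v <ᵇ m then x else y) ≡ x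
if-< {v = v} {m} v<m with v <ᵇ m | <⇒<ᵇ v<m
... | true | _ = refl

if-≥ : ∀ {A : Set} {v m} {x y : A} → m ≤ v → (if v <ᵇ m then x else y) ≡ y
if-≥ {v = v} {m} m≤v with v <ᵇ m | <ᵇ⇒< v m
... | true  | v<m = contradiction m≤v (<⇒≱ (v<m tt))
... | false | _   = refl

listed-finite : ∀ {U : Set} (L : List U) → (∀ u → u ∈ L) → FiniteSet U
listed-finite L all = length L , Data.List.lookup L , λ u →
  index (all u) , λ { refl → sym (lookup-index (all u)) }

ℕ-embeds-infinite : ∀ {U : Set} (g : ℕ → U) → (∀ {i j} → g i ≡ g j → i ≡ j) → ¬ FiniteSet U
ℕ-embeds-infinite {U} g g-inj (m , f , onto) with pigeonhole (n<1+n m) (λ i → proj₁ (onto (g (toℕ i))))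
... | i , j , i<j , same = <⇒≢ i<j (g-inj (trans (sym (proj₂ (onto (g (toℕ i))) refl))
                             (trans (cong f same) (proj₂ (onto (g (toℕ j))) refl))))

Decides : ∀ {k} → PR 1 → (BSR k → Set₁) → Set₁
Decides f Sat = ∀ ψ → (Sat ψ → f ∙ (code ψ ∷ []) ⇓ 1) × (¬ Sat ψ → f ∙ (code ψ ∷ []) ⇓ 0)

module _ {k N : ℕ} {φ : Formula k} {qf : IsQF φ} {ψ : BSR k} (M : Structure k) where
  open Structure M
  open Sem U {k}

  close-elim : close N φ qf ≡ ψ → Models M ψ → Σ (Store U) (Alls (downFrom N) (λ t → ⟦ φ ⟧ t heap))
  close-elim refl = Stores.exs-elim U {k} (downFrom (suc (codeF φ)))

  close-intro : close N φ qf ≡ ψ → (∀ E → Exs E (Alls (downFrom N) (λ t → ⟦ φ ⟧ t heap)) store) → Models M ψ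
  close-intro refl m = m (downFrom (suc (codeF φ)))

-- The sentence

module Sentence (k′ : ℕ) where

  k : ℕ
  k = 2 + k′

  -- The universal variables are those below bv 0: 47 for the unfolding and k′ for unused components.
  bv : ℕ → Var
  bv i = 47 + (k′ + i)

  cell : Var → Var → Var → Formula k
  cell x y z = (x ↦ (y ∷ z ∷ replicate k′ (bv 0))) ⋆ tt

  implies : Formula k → Formula k → Formula k
  implies φ ψ = ¬ᶠ (φ ∧ (¬ᶠ ψ))

  ⟨_⟩ : Term → Var
  ⟨ # i ⟩ = i
  ⟨ κ i ⟩ = bv (toℕ i)

  equations : Equations → Formula k
  equations []             = tt
  equations ((x , y) ∷ es) = (⟨ x ⟩ ≈ ⟨ y ⟩) ∧ equations es

  pads : Vec Var k′
  pads = tabulate λ i → 47 + toℕ i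

  allNil : ∀ {n} → Vec Var n → Formula k
  allNil []       = tt
  allNil (x ∷ xs) = (x ≈ bv 0) ∧ allNil xs

  -- Together these make the antecedent `unfolded` true from every cell of a model: `padded` turns
  -- any cell into the form that `cell` describes, and closure provides the cells below it.
  padded closedˡ closedʳ : Formula k
  padded  = implies ((0 ↦ (1 ∷ 2 ∷ pads)) ⋆ tt) (allNil pads)
  closedˡ = implies (cell 0 1 2) (allocated 1)
  closedʳ = implies (cell 0 1 2) (allocated 2)

  unfolded : ℕ → List ℕ → Formula k
  unfolded m []       = tt
  unfolded m (p ∷ ps) = cell p m (suc m) ∧ unfolded (2 + m) ps

  rule : ℕ → Rule → Formula k
  rule i (es , fs) = implies (unfolded 1 parents ∧ ((⟨ mark ⟩ ≈ bv 2) ∧ ((⟨ tag ⟩ ≈ bv i) ∧ equations es)))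
                             (equations fs)

  ruleList : ℕ → List Rule → Formula k
  ruleList i []       = tt
  ruleList i (ρ ∷ ρs) = rule i ρ ∧ ruleList i ρs

  ruleTable : ℕ → Formula k
  ruleTable zero    = tt
  ruleTable (suc i) = ruleList i (rules i) ∧ ruleTable i

  -- In a described tree, the label i of a leaf refers to the variable bv i.
  describe : ℕ → Tree → Formula k
  describe b (leaf i)   = bv b ≈ bv i
  describe b (node p q) = cell (bv b) (bv (suc b)) (bv (suc b + size p)) ∧
    (describe (suc b) p ∧ describe (suc b + size p) q)

  -- Labels 12 and 13 stand for the input and for the premises of the root judgement.
  claim : Prog → Tree
  claim p = node (leaf 2) (node (node ⌜ p ⌝ (node (leaf 12) (leaf 0))) (node (leaf 0) (leaf 13)))

  -- The self-pointing cell of nil and the inequality of nil and one are what refutes a true value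
  -- 1: `numeral 1` has one as its right child, but the right child of nil is nil.
  frame : Prog → Formula k
  frame p = padded ∧ (closedˡ ∧ (closedʳ ∧ (ruleTable 12 ∧ (cell (bv 0) (bv 0) (bv 0) ∧
    ((¬ᶠ (bv 0 ≈ bv 1)) ∧ describe 14 (claim p))))))

  -- With n the code of the frame, these variables do not occur in the frame.
  chainVar : ℕ → ℕ → Var
  chainVar n i = bv (14 + (n + i))

  chain : ℕ → ℕ → Formula k
  chain n zero    = chainVar n 0 ≈ bv 0
  chain n (suc i) = cell (chainVar n (suc i)) (chainVar n i) (bv 1) ∧ chain n i

  inputIs : ℕ → Formula k
  inputIs n = (bv 12 ≈ chainVar n n) ∧ chain n n

  equations-qf : ∀ es → IsQF (equations es)
  equations-qf []       = tt
  equations-qf (e ∷ es) = tt , equations-qf es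

  allNil-qf : ∀ {n} (xs : Vec Var n) → IsQF (allNil xs)
  allNil-qf []       = tt
  allNil-qf (x ∷ xs) = tt , allNil-qf xs

  unfolded-qf : ∀ m ps → IsQF (unfolded m ps)
  unfolded-qf m []       = tt
  unfolded-qf m (p ∷ ps) = (tt , tt) , unfolded-qf (2 + m) ps

  ruleList-qf : ∀ i ρs → IsQF (ruleList i ρs)
  ruleList-qf i []              = tt
  ruleList-qf i ((es , fs) ∷ ρs) =
    ((unfolded-qf 1 parents , tt , tt , equations-qf es) , equations-qf fs) , ruleList-qf i ρs

  ruleTable-qf : ∀ i → IsQF (ruleTable i)
  ruleTable-qf zero    = tt
  ruleTable-qf (suc i) = ruleList-qf i (rules i) , ruleTable-qf i

  describe-qf : ∀ b t → IsQF (describe b t)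
  describe-qf b (leaf i)   = tt
  describe-qf b (node p q) = (tt , tt) , describe-qf (suc b) p , describe-qf (suc b + size p) q

  frame-qf : ∀ p → IsQF (frame p)
  frame-qf p = ((tt , tt) , allNil-qf pads) , ((tt , tt) , tt , tt) , ((tt , tt) , tt , tt) ,
    ruleTable-qf 12 , (tt , tt) , tt , describe-qf 14 (claim p)

  chain-qf : ∀ n i → IsQF (chain n i)
  chain-qf n zero    = tt
  chain-qf n (suc i) = (tt , tt) , chain-qf n i

  matrix-qf : ∀ p n → IsQF (frame p ∧ inputIs n)
  matrix-qf p n = frame-qf p , tt , chain-qf n n

  -- Codes are astronomically large numbers; abstracting from codeF ensures that none is ever computed.
  module Codes (c : Formula k → ℕ) (c∧ : ℕ → ℕ → ℕ)
    (c-∧ : ∀ φ ψ → c (φ ∧ ψ) ≡ c∧ (c φ) (c ψ))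
    (∧ᶜ : ∀ {m} (X Y : Vec ℕ m → ℕ) → Computable X → Computable Y → Computable (λ xs → c∧ (X xs) (Y xs)))
    (≈ᶜ : ∀ {m} (X Y : Vec ℕ m → ℕ) → Computable X → Computable Y → Computable (λ xs → c (X xs ≈ Y xs)))
    (cellᶜ : ∀ {m} (X Y : Vec ℕ m → ℕ) → Computable X → Computable Y →
             Computable (λ xs → c ((X xs ↦ (Y xs ∷ bv 1 ∷ replicate k′ (bv 0))) ⋆ tt))) where

    chainVarᶜ : ∀ {m} {X Y : Vec ℕ m → ℕ} → Computable X → Computable Y →
      Computable (λ xs → chainVar (X xs) (Y xs))
    chainVarᶜ X Y = shift 47 (shift k′ (shift 14 (addition X Y)))

    chainᶜ : Computable {2} (λ xs → c (chain (lookup xs 1F) (lookup xs 0F)))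
    chainᶜ = primitiveRecursion {R = λ xs → c (chain (lookup xs 1F) (lookup xs 0F))}
      (≈ᶜ _ _ (chainVarᶜ (projection 0F) (constant 0)) (constant (bv 0)))
      (∧ᶜ _ _ (cellᶜ _ _ (chainVarᶜ (projection 2F) (successor (projection 0F)))
                         (chainVarᶜ (projection 2F) (projection 0F)))
          (projection 1F))
      (λ { (n ∷ []) → refl }) (λ { i (n ∷ []) → sym (c-∧ _ (chain n i)) })

    -- The code of the sentence depends on `φ` only through `c φ`: by `c-∧` it is an arithmetic
    -- expression in `c φ` and the code of a chain.
    diagonalᶜ : Σ (PR 1) λ p → ∀ φ → let m = c (φ ∧ inputIs (c φ)) in
      p ∙ (c φ ∷ []) ⇓ pair (codeL (downFrom (suc m))) (pair (codeL (downFrom (bv 0))) m)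
    diagonalᶜ = proj₁ result , λ φ →
      subst (λ m → proj₁ result ∙ (c φ ∷ []) ⇓
                     pair (codeL (downFrom (suc m))) (pair (codeL (downFrom (bv 0))) m))
            (sym (trans (c-∧ φ _) (cong (c∧ (c φ)) (c-∧ (bv 12 ≈ chainVar (c φ) (c φ)) (chain (c φ) (c φ))))))
            (proj₂ result (c φ ∷ []))
      where
      result = prenex-code (codeL (downFrom (bv 0)))
        (λ xs → c∧ (lookup xs 0F) (c∧ (c (bv 12 ≈ chainVar (lookup xs 0F) (lookup xs 0F)))
                                      (c (chain (lookup xs 0F) (lookup xs 0F)))))
        (∧ᶜ _ _ (projection 0F) (∧ᶜ _ _
          (≈ᶜ _ _ (constant (bv 12)) (chainVarᶜ (projection 0F) (projection 0F)))
          (compose₂ {F = λ xs → c (chain (lookup xs 1F) (lookup xs 0F))} chainᶜ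
            (projection 0F) (projection 0F))))

  open Codes codeF (λ a b → pair 5 (pair a b)) (λ _ _ → refl) ∧-code (≈-code {k})
    (pointsTo-code (bv 1 ∷ replicate k′ (bv 0)))
    public using (diagonalᶜ)

  abstract
    diagonal-computable : Σ (PR 1) λ p → ∀ (φ : Formula k) (qf : IsQF (φ ∧ inputIs (codeF φ))) →
      p ∙ (codeF φ ∷ []) ⇓ code (close (bv 0) (φ ∧ inputIs (codeF φ)) qf)
    diagonal-computable = proj₁ diagonalᶜ , λ φ qf → proj₂ diagonalᶜ φ

  module Cells (U : Set) (_≟ᵁ_ : DecidableEquality U) where
    open Sem U {k}
    open Heaps U _≟ᵁ_ {k}

    row : U → U → U → Vec U k
    row z a b = a ∷ b ∷ replicate k′ z

    cell-row : ∀ (t : Store U) y z → vmap t (y ∷ z ∷ replicate k′ (bv 0)) ≡ row (t (bv 0)) (t y) (t z)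
    cell-row t y z = cong (λ w → t y ∷ t z ∷ w) (Vecₚ.map-replicate t (bv 0) k′)

    cell-intro : ∀ {x y z t h} → FinDom h → h (t x) ≡ just (row (t (bv 0)) (t y) (t z)) → ⟦ cell x y z ⟧ t h
    cell-intro {x} {y} {z} {t} fin eq = pointsTo-intro fin (trans eq (cong just (sym (cell-row t y z))))

    cell-elim : ∀ {x y z t h} → ⟦ cell x y z ⟧ t h → h (t x) ≡ just (row (t (bv 0)) (t y) (t z))
    cell-elim {x} {y} {z} {t} m =
      trans (pointsTo-elim {x} {y ∷ z ∷ replicate k′ (bv 0)} m) (cong just (cell-row t y z))

  -- Soundness

  module Soundness (U : Set) (_≟ᵁ_ : DecidableEquality U) (p : Prog) (n : ℕ)
    (h : Heap U k) (fin : FinDom h) (s : Store U)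
    (model : Sem.Alls U {k} (downFrom (bv 0))
               (λ t → Sem.⟦_⟧ U (frame p ∧ inputIs n) t h) s) where
    open Sem U {k}
    open Stores U {k}
    open Heaps U _≟ᵁ_ {k}
    open Cells U _≟ᵁ_

    instantiate : ∀ t → (∀ v → bv 0 ≤ v → t v ≡ s v) → ⟦ frame p ∧ inputIs n ⟧ t h
    instantiate t eq = prenex-elim (frame p ∧ inputIs n) (matrix-qf p n) (bv 0) eq model

    γ : ℕ → U
    γ i = s (bv i)

    -- Implication is encoded by negations, so constructively its conclusion must be decidable. The
    -- conclusions eliminated this way are conjunctions of equalities, decided by `_≟ᵁ_`.
    implies-elim : ∀ {A B : Set} → Dec B → ¬ (A × ¬ B) → A → B
    implies-elim dec m a = decidable-stable dec λ ¬b → m (a , ¬b)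

    -- An unallocated element counts as its own child merely to keep the maps total.
    childˡ childʳ : Maybe (Vec U k) → U → U
    childˡ (just (a ∷ _))     u = a
    childˡ nothing            u = u
    childʳ (just (_ ∷ b ∷ _)) u = b
    childʳ nothing            u = u

    abstract
      l r : U → U
      l u = childˡ (h u) u
      r u = childʳ (h u) u

      children : ∀ {u a b w} → h u ≡ just (a ∷ b ∷ w) → l u ≡ a × r u ≡ b
      children {u} eq = cong (λ m → childˡ m u) eq , cong (λ m → childʳ m u) eq

    Alloc : U → Set
    Alloc u = Σ (Vec U k) λ w → h u ≡ just w

    allNil-dec : ∀ {j} (xs : Vec Var j) t → Dec (⟦ allNil xs ⟧ t h)
    allNil-dec []       t = yes tt
    allNil-dec (x ∷ xs) t = (t x ≟ᵁ t (bv 0)) ×-dec allNil-dec xs t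

    allNil-elim : ∀ {j} (xs : Vec Var j) t → ⟦ allNil xs ⟧ t h → vmap t xs ≡ replicate j (t (bv 0))
    allNil-elim []       t _         = refl
    allNil-elim (x ∷ xs) t (eq , eqs) = cong₂ _∷_ eq (allNil-elim xs t eqs)

    bound : ∀ {j v} → j ≤ 47 → bv 0 ≤ v → j ≤ v
    bound j≤ bv≤ = ≤-trans j≤ (≤-trans (m≤m+n 47 (k′ + 0)) bv≤)

    shape : ∀ {u} → Alloc u → h u ≡ just (row (γ 0) (l u) (r u))
    shape {u} (a ∷ b ∷ w , eq) =
      trans eq (cong just (trans (cong (λ w → a ∷ b ∷ w) w≡) (sym (cong₂ (row (γ 0)) l≡ r≡))))
      where
      l≡ : l u ≡ a
      l≡ = proj₁ (children eq)
      r≡ : r u ≡ b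
      r≡ = proj₂ (children eq)
      -- Three values and 44 fillers occupy variables 0 to 46, so that `w` lands on `pads`, which
      -- start at 47.
      xs : List U
      xs = u ∷ a ∷ b ∷ (Data.List.replicate 44 u ++ toList w)
      t : Store U
      t = xs ▹ s
      beyond : ∀ v → bv 0 ≤ v → t v ≡ s v
      beyond v v≥ = ▹-beyond xs s v
        (≤-trans (≤-reflexive (cong (47 +_) (trans (Vecₚ.length-toList w) (sym (+-identityʳ k′))))) v≥)
      pads≡ : vmap t pads ≡ w
      pads≡ = trans (sym (Vecₚ.tabulate-∘ t (λ i → 47 + toℕ i))) (tabulate-▹ w (λ j → s (47 + j)))
      w≡ : w ≡ replicate k′ (γ 0)
      w≡ = trans (sym pads≡) (trans
        (allNil-elim pads t (implies-elim (allNil-dec pads t) (proj₁ (proj₁ (instantiate t beyond)))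
          (pointsTo-intro {0} {1 ∷ 2 ∷ pads} {t} fin
            (trans eq (cong (λ w → just (a ∷ b ∷ w)) (sym pads≡))))))
        (cong (replicate k′) (beyond (bv 0) ≤-refl)))

    module _ {u} (al : Alloc u) where
      private
        t : Store U
        t = (u ∷ l u ∷ r u ∷ []) ▹ s
        m = proj₁ (instantiate t λ v v≥ → ▹-beyond (u ∷ l u ∷ r u ∷ []) s v (bound (s≤s (s≤s (s≤s z≤n))) v≥))
        c : ⟦ cell 0 1 2 ⟧ t h
        c = cell-intro {0} {1} {2} {t} fin (shape al)

      alloc-l : Alloc (l u)
      alloc-l with h (l u) in eq
      ... | just w  = w , refl
      ... | nothing = ⊥-elim (proj₁ (proj₂ m) (c , not-allocated {1} {t} eq))

      alloc-r : Alloc (r u)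
      alloc-r with h (r u) in eq
      ... | just w  = w , refl
      ... | nothing = ⊥-elim (proj₁ (proj₂ (proj₂ m)) (c , not-allocated {2} {t} eq))

    equations-dec : ∀ es t → Dec (⟦ equations es ⟧ t h)
    equations-dec []             t = yes tt
    equations-dec ((x , y) ∷ es) t = (t ⟨ x ⟩ ≟ᵁ t ⟨ y ⟩) ×-dec equations-dec es t

    ruleTable-elim : ∀ {t} N i → i < N → ⟦ ruleTable N ⟧ t h → ⟦ ruleList i (rules i) ⟧ t h
    ruleTable-elim (suc N) i i<N (m , ms) with i ≟ N
    ... | yes refl = m
    ... | no  i≢N  = ruleTable-elim N i (≤∧≢⇒< (s≤s⁻¹ i<N) i≢N) ms

    module _ (c : U) where

      ν : ℕ → U
      ν = unfold l r s c

      value-ν : ∀ x → ν ⟨ x ⟩ ≡ value ν γ x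
      value-ν (# i) = refl
      value-ν (κ i) = refl

      equations-intro : ∀ es → Solves ν γ es → ⟦ equations es ⟧ ν h
      equations-intro []             _          = tt
      equations-intro ((x , y) ∷ es) (eq , eqs) =
        trans (value-ν x) (trans eq (sym (value-ν y))) , equations-intro es eqs

      equations-elim : ∀ es → ⟦ equations es ⟧ ν h → Solves ν γ es
      equations-elim []             _          = tt
      equations-elim ((x , y) ∷ es) (eq , eqs) =
        trans (sym (value-ν x)) (trans eq (value-ν y)) , equations-elim es eqs

      unfolded-intro : ∀ m ps → Ordered m ps → Links l r ν m ps → (∀ v → v < m → Alloc (ν v)) →
        ⟦ unfolded m ps ⟧ ν h
      unfolded-intro m []       _           _                _  = tt
      unfolded-intro m (p ∷ ps) (p<m , ord) ((eqˡ , eqʳ) , links) al =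
        cell-intro {p} {m} {suc m} {ν} fin
          (trans (shape (al p p<m)) (cong just (sym (cong₂ (row (γ 0)) eqˡ eqʳ)))) ,
        unfolded-intro (2 + m) ps ord links
          (below-two (λ v → Alloc (ν v)) al (subst Alloc (sym eqˡ) (alloc-l (al p p<m)))
                                            (subst Alloc (sym eqʳ) (alloc-r (al p p<m))))

      unfolded-ν : Alloc c → ⟦ unfolded 1 parents ⟧ ν h
      unfolded-ν al = unfolded-intro 1 parents parents-ordered (unfold-links l r s c)
        λ { zero _ → al ; (suc v) (s≤s ()) }

      ruleList-elim : ∀ i ρs → ⟦ ruleList i ρs ⟧ ν h → Alloc c → ν 1 ≡ γ 2 → ν 11 ≡ γ i → All (Obeys ν γ) ρs
      ruleList-elim i []               _        _  _ _ = []
      ruleList-elim i ((es , fs) ∷ ρs) (m , ms) al j e =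
        (λ sol → equations-elim fs (implies-elim (equations-dec fs ν) m
          (unfolded-ν al , j , e , equations-intro es sol))) ∷
        ruleList-elim i ρs ms al j e

      lawful : ∀ i → i < 12 → Alloc c → ν 1 ≡ γ 2 → ν 11 ≡ γ i → All (Obeys ν γ) (rules i)
      lawful i i<12 = ruleList-elim i (rules i) (ruleTable-elim 12 i i<12
        (proj₁ (proj₂ (proj₂ (proj₂ (proj₁ (instantiate ν λ v v≥ →
          unfold-beyond l r s c v (bound ≤-refl v≥))))))))

    -- Recursion is on the tree, because the graph in the heap need not be well founded. One element
    -- may represent several trees.
    Represents : U → Tree → Set
    Represents x (leaf i)   = x ≡ γ i
    Represents x (node a b) = Represents (l x) a × Represents (r x) b

    represents : ∀ {x y} t → x ≡ y → Represents y t → Represents x t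
    represents t refl rep = rep

    progOf argOf resOf sub₁ sub₂ : U → U
    progOf c = l (l (r c))
    argOf c  = r (l (r c))
    resOf c  = l (r (r c))
    sub₁ c   = l (r (r (r c)))
    sub₂ c   = r (r (r (r c)))

    module _ {c} (al : Alloc c) where
      alloc₁ : Alloc (sub₁ c)
      alloc₁ = alloc-l (alloc-r (alloc-r (alloc-r al)))
      alloc₂ : Alloc (sub₂ c)
      alloc₂ = alloc-r (alloc-r (alloc-r (alloc-r al)))

    abstract
      law : ∀ i {_ : True (i <? 12)} {c} → Alloc c → l c ≡ γ 2 → l (progOf c) ≡ γ i →
        All (Obeys (unfold l r s c) γ) (rules i)
      law i {i<12} {c} = lawful c i (toWitness i<12)

    -- Induction on the evaluation. At each judgement the rule of its tag forces the premises in the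
    -- heap to be judgements about the right subprograms and arguments, so the induction hypotheses
    -- apply to them and fix the result.
    sound : ∀ {q a v} → Eval q a v → ∀ {c} → Alloc c → l c ≡ γ 2 →
      Represents (progOf c) ⌜ q ⌝ → Represents (argOf c) a → Represents (resOf c) v
    sound nil al j (t , _) _ with law 3 al j t
    ... | x ∷ [] = proj₁ (x tt)
    sound (id {a}) al j (t , _) ra with law 4 al j t
    ... | x ∷ [] = represents a (proj₁ (x tt)) ra
    sound (cons₁ {a}) al j (t , _) ra with law 5 al j t
    ... | x ∷ [] with x tt
    ...   | e , f , _ = represents a e ra , f
    sound (hd {a}) al j (t , _) (ra , _) with law 6 al j t
    ... | x ∷ [] = represents a (proj₁ (x tt)) ra
    sound (tl {b = b}) al j (t , _) (_ , rb) with law 7 al j t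
    ... | x ∷ [] = represents b (proj₁ (x tt)) rb
    sound (fork {p} {q} {a} {v} {w} d e) al j (t , rp , rq) ra with law 8 al j t
    ... | x ∷ [] with x tt
    ...   | j₁ , q₁ , a₁ , v₁ , j₂ , q₂ , a₂ , v₂ , _ =
      represents v v₁ (sound d (alloc₁ al) j₁ (represents ⌜ p ⌝ q₁ rp) (represents a a₁ ra)) ,
      represents w v₂ (sound e (alloc₂ al) j₂ (represents ⌜ q ⌝ q₂ rq) (represents a a₂ ra))
    sound (comp {p} {q} {a} {b} {v} d e) al j (t , rp , rq) ra with law 9 al j t
    ... | x ∷ [] with x tt
    ...   | j₁ , q₁ , a₁ , j₂ , q₂ , a₂ , v₂ , _ =
      represents v v₂ (sound e (alloc₂ al) j₂ (represents ⌜ p ⌝ q₂ rp) (represents b a₂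
        (sound d (alloc₁ al) j₁ (represents ⌜ q ⌝ q₁ rq) (represents a a₁ ra))))
    sound (rec0 {p} {q} {xs} {v} d) al j (t , rp , rq) (z , rxs) with law 10 al j t
    ... | x ∷ _ ∷ [] with x (z , tt)
    ...   | j₁ , q₁ , a₁ , v₁ , _ =
      represents v v₁ (sound d (alloc₁ al) j₁ (represents ⌜ p ⌝ q₁ rp) (represents xs a₁ rxs))
    sound (recS {p} {q} {n} {xs} {z} {v} d e) al j rpq@(t , rp , rq) ((rn , o) , rxs) with law 10 al j t
    ... | _ ∷ x ∷ [] with x (o , tt)
    ...   | j₁ , q₁ , n₁ , a₁ , j₂ , q₂ , n₂ , z₂ , a₂ , v₂ , _ =
      represents v v₂ (sound e (alloc₂ al) j₂ (represents ⌜ q ⌝ q₂ rq)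
        (represents n n₂ rn , represents z z₂ rz , represents xs a₂ rxs))
      where
      rz : Represents (resOf (sub₁ _)) z
      rz = sound d (alloc₁ al) j₁ (represents ⌜ rec p q ⌝ q₁ rpq) (represents n n₁ rn , represents xs a₁ rxs)
    sound (search0 {p} {z} {xs} d) al j (t , rp , _) ra with law 11 al j t
    ... | x ∷ y ∷ _ ∷ [] with x tt
    ...   | j₁ , q₁ , a₁ , _ =
      represents z (proj₁ (y (sound d (alloc₁ al) j₁ (represents ⌜ p ⌝ q₁ rp)
        (represents (node z xs) a₁ ra) , tt))) (proj₁ ra)
    sound (searchS {p} {z} {xs} {w} {v} d e) al j rs@(t , rp , _) ra with law 11 al j t
    ... | x ∷ _ ∷ y ∷ [] with x tt
    ...   | j₁ , q₁ , a₁ , _ with y (proj₂ (sound d (alloc₁ al) j₁ (represents ⌜ p ⌝ q₁ rp)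
                                              (represents (node z xs) a₁ ra)) , tt)
    ...     | j₂ , q₂ , z₂ , o₂ , a₂ , v₂ , _ =
      represents v v₂ (sound e (alloc₂ al) j₂ (represents ⌜ search p ⌝ q₂ rs)
        ((represents z z₂ (proj₁ ra) , o₂) , represents xs a₂ (proj₂ ra)))

    abstract
      own : ⟦ frame p ∧ inputIs n ⟧ s h
      own = instantiate s λ _ _ → refl

    cell-node : ∀ {x y z} → ⟦ cell x y z ⟧ s h → Alloc (s x) × l (s x) ≡ s y × r (s x) ≡ s z
    cell-node {x} {y} {z} m = (_ , eq) , children eq
      where
      eq : h (s x) ≡ just (row (γ 0) (s y) (s z))
      eq = cell-elim {x} {y} {z} m

    describe-represents : ∀ b t → ⟦ describe b t ⟧ s h → Represents (γ b) t
    describe-represents b (leaf i)   m              = m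
    describe-represents b (node p q) (m , mp , mq) =
      represents p (proj₁ (proj₂ cn)) (describe-represents (suc b) p mp) ,
      represents q (proj₂ (proj₂ cn)) (describe-represents (suc b + size p) q mq)
      where
      cn = cell-node {bv b} {bv (suc b)} {bv (suc b + size p)} m

    chain-represents : ∀ i → ⟦ chain n i ⟧ s h → Represents (s (chainVar n i)) (numeral i)
    chain-represents zero    m        = m
    chain-represents (suc i) (m , ms) =
      represents (numeral i) (proj₁ (proj₂ cn)) (chain-represents i ms) , proj₂ (proj₂ cn)
      where
      cn = cell-node {chainVar n (suc i)} {chainVar n i} {bv 1} m

    no-value-one : ¬ Eval p (tuple (n ∷ [])) (numeral 1)
    no-value-one d = absurd own
      where
      root-value : ⟦ describe 14 (claim p) ⟧ s h → ⟦ inputIs n ⟧ s h → Represents (γ 0) (numeral 1)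
      root-value root (input , ch) = go (describe-represents 14 (claim p) root)
        where
        go : Represents (γ 14) (claim p) → Represents (γ 0) (numeral 1)
        go (j , (rp , ri , rn) , re , _) = represents (numeral 1) (sym re)
          (sound d (proj₁ (cell-node {bv 14} {bv 15} {bv (15 + size (leaf 2))} (proj₁ root))) j rp
            (represents (numeral n) (trans ri input) (chain-represents n ch) , rn))
      absurd : ⟦ frame p ∧ inputIs n ⟧ s h → ⊥
      absurd ((_ , _ , _ , _ , nil-cell , nil≢one , root) , inp) =
        -- The claimed result nil would represent `numeral 1`, so its right child would be both nil
        -- and one.
        nil≢one (trans (sym (proj₂ (proj₂ (cell-node {bv 0} {bv 0} {bv 0} nil-cell))))
                       (proj₂ (root-value root inp)))

  -- Completeness

  -- The universe is cut out by isElement: either the subtrees of big or all trees.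
  module Completeness (p : Prog) (n : ℕ) (D : Derivation p (tuple (n ∷ [])) (numeral 0))
    (frame-below : ∀ v → Free v (frame p) → v ≤ n)
    (big : Tree) (big-good : Good big) (root-∈ : tree D ∈ subtrees big)
    (leaf-∈ : ∀ i → i < 12 → leaf i ∈ subtrees big)
    (isElement : Tree → Bool) (element : ∀ {t} → t ∈ subtrees big → T (isElement t)) where

    U : Set
    U = Elements isElement

    _≟ᵁ_ : DecidableEquality U
    u ≟ᵁ v with proj₁ u ≟ᵗ proj₁ v
    ... | yes eq = yes (U-≡ eq)
    ... | no  ≢  = no λ { refl → ≢ refl }

    open Sem U {k}
    open Stores U {k}
    open Heaps U _≟ᵁ_ {k}
    open Cells U _≟ᵁ_

    nilᵁ : U
    nilᵁ = leaf 0 , element (leaf-∈ 0 (s≤s z≤n))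

    _∈ᵇ : Tree → Set
    t ∈ᵇ = t ∈ subtrees big

    -- Only subtrees of `big` own a cell, which keeps the heap finite even when the universe
    -- consists of all trees.
    content : (t : Tree) → Dec (t ∈ᵇ) → Maybe (Vec U k)
    content t (yes t∈) = just (row nilᵁ (left t , element (subtrees-trans big (left-∈ t) t∈))
                                        (right t , element (subtrees-trans big (right-∈ t) t∈)))
    content t (no _)   = nothing

    heap : Heap U k
    heap (t , _) = content t (t ∈? subtrees big)

    heap-intro : ∀ {u a b} → proj₁ u ∈ᵇ → proj₁ a ≡ left (proj₁ u) → proj₁ b ≡ right (proj₁ u) →
      heap u ≡ just (row nilᵁ a b)
    heap-intro {u} {a} {b} u∈ ea eb = go (proj₁ u ∈? subtrees big)
      where
      go : ∀ d → content (proj₁ u) d ≡ just (row nilᵁ a b)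
      go (yes _)  = cong just (cong₂ (row nilᵁ) (U-≡ (sym ea)) (U-≡ (sym eb)))
      go (no u∉) = contradiction u∈ u∉

    heap-elim : ∀ {u a b w} → heap u ≡ just (a ∷ b ∷ w) →
      proj₁ u ∈ᵇ × proj₁ a ≡ left (proj₁ u) × proj₁ b ≡ right (proj₁ u) × w ≡ replicate k′ nilᵁ
    heap-elim {u} {a} {b} {w} = go (proj₁ u ∈? subtrees big)
      where
      go : ∀ d → content (proj₁ u) d ≡ just (a ∷ b ∷ w) →
        proj₁ u ∈ᵇ × proj₁ a ≡ left (proj₁ u) × proj₁ b ≡ right (proj₁ u) × w ≡ replicate k′ nilᵁ
      go (yes u∈) refl = u∈ , refl , refl , refl

    heap-finite : FinDom heap
    heap-finite = elements isElement element (subtrees big) (λ t∈ → t∈) ,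
      λ { u (a ∷ b ∷ w) eq →
        elements-∈ isElement element u (subtrees big) (λ t∈ → t∈) (proj₁ (heap-elim {u} {a} {b} {w} eq)) }

    constants : ℕ → Tree
    constants i =
      if i ≡ᵇ 12 then numeral n else
      if i ≡ᵇ 13 then node (Derivation.s₁ D) (Derivation.s₂ D) else leaf i

    constants-leaf : ∀ i → i < 12 → constants i ≡ leaf i
    constants-leaf i i<12
      rewrite ≢⇒≡ᵇ-false i 12 (<⇒≢ i<12) | ≢⇒≡ᵇ-false i 13 (<⇒≢ (m<n⇒m<1+n i<12)) = refl

    fill-claim : fill constants (claim p) ≡ tree D
    fill-claim = cong (λ t → node (leaf 2) (node (node t _) _))
      (fill-labels ⌜ p ⌝ (prog-labels (λ i i<12 _ → constants-leaf i i<12) p))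

    -- The intended values of the variables bv i.
    environment : ℕ → Tree
    environment i = if i <ᵇ 14 then constants i else entry constants (subtrees (claim p)) (i ∸ 14)

    environment-constants : ∀ i → i < 14 → environment i ≡ constants i
    environment-constants i i<14 with i <ᵇ 14 | <⇒<ᵇ i<14
    ... | true | _ = refl

    environment-leaf : ∀ i → i < 12 → environment i ≡ leaf i
    environment-leaf i i<12 =
      trans (environment-constants i (≤-trans i<12 (m≤m+n 12 2))) (constants-leaf i i<12)

    claim-labels : Labels (λ i → environment i ≡ constants i) (claim p)
    claim-labels =
      refl ,
      (prog-labels (λ i i<12 _ → trans (environment-leaf i i<12) (sym (constants-leaf i i<12))) p ,
        refl , refl) ,
      refl , refl

    node-∈ : ∀ {a b} → node a b ∈ᵇ → a ∈ᵇ × b ∈ᵇ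
    node-∈ {a} {b} ab∈ =
      subtrees-trans big (left-∈ (node a b)) ab∈ , subtrees-trans big (right-∈ (node a b)) ab∈

    input-∈ : numeral n ∈ᵇ
    input-∈ = proj₁ (node-∈ (proj₂ (node-∈ (proj₁ (node-∈ (proj₂ (node-∈ root-∈)))))))

    premises-∈ : node (Derivation.s₁ D) (Derivation.s₂ D) ∈ᵇ
    premises-∈ = proj₂ (node-∈ (proj₂ (node-∈ (proj₂ (node-∈ root-∈)))))

    numeral-∈ : ∀ i → i ≤ n → numeral i ∈ᵇ
    numeral-∈ i i≤n = subtrees-trans big (below n i≤n) input-∈
      where
      below : ∀ n → i ≤ n → numeral i ∈ subtrees (numeral n)
      below n i≤n with m≤n⇒m<n∨m≡n i≤n
      below n       _ | inj₂ refl = subtrees-self (numeral n)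
      below (suc n) _ | inj₁ i<n  = there (∈-++⁺ˡ (below n (s≤s⁻¹ i<n)))

    constants-∈ : ∀ i → i < 14 → constants i ∈ᵇ
    constants-∈ i i<14 with m≤n⇒m<n∨m≡n (s≤s⁻¹ i<14)
    ... | inj₂ refl = premises-∈
    ... | inj₁ i<13 with m≤n⇒m<n∨m≡n (s≤s⁻¹ i<13)
    ...   | inj₂ refl = input-∈
    ...   | inj₁ i<12 = subst _∈ᵇ (sym (constants-leaf i i<12)) (leaf-∈ i i<12)

    environment-∈ : ∀ i → environment i ∈ᵇ
    environment-∈ i with i <ᵇ 14 | <ᵇ⇒< i 14
    ... | true  | small = constants-∈ i (small tt)
    ... | false | _     = entry-∈ (subtrees (claim p)) (i ∸ 14) (leaf-∈ 0 (s≤s z≤n))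
      λ {t} t∈ → subtrees-trans big
        (subst (λ u → fill constants t ∈ subtrees u) fill-claim (fill-∈ (claim p) t∈)) root-∈

    implies-intro : ∀ {A B : Set} → (A → B) → ¬ (A × ¬ B)
    implies-intro f (a , ¬b) = ¬b (f a)

    module _ (t : Store U) (t-env : ∀ i → proj₁ (t (bv i)) ≡ environment i) where

      τ : ℕ → Tree
      τ v = proj₁ (t v)

      τ-leaf : ∀ i → i < 12 → τ (bv i) ≡ leaf i
      τ-leaf i i<12 = trans (t-env i) (environment-leaf i i<12)

      nil≡ : t (bv 0) ≡ nilᵁ
      nil≡ = U-≡ (τ-leaf 0 (s≤s z≤n))

      make-cell : ∀ {x y z} → τ x ∈ᵇ → τ y ≡ left (τ x) → τ z ≡ right (τ x) → ⟦ cell x y z ⟧ t heap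
      make-cell {x} {y} {z} x∈ ey ez = cell-intro {x} {y} {z} {t} heap-finite
        (trans (heap-intro {t x} {t y} {t z} x∈ ey ez) (cong (λ u → just (row u (t y) (t z))) (sym nil≡)))

      read-cell : ∀ {x y z} → ⟦ cell x y z ⟧ t heap → τ x ∈ᵇ × τ y ≡ left (τ x) × τ z ≡ right (τ x)
      read-cell {x} {y} {z} m with heap-elim {t x} {t y} {t z} (cell-elim {x} {y} {z} {t} m)
      ... | x∈ , ey , ez , _ = x∈ , ey , ez

      allNil-intro : ∀ {j} (xs : Vec Var j) → vmap t xs ≡ replicate j nilᵁ → ⟦ allNil xs ⟧ t heap
      allNil-intro []       _  = tt
      allNil-intro (x ∷ xs) eq =
        trans (Vecₚ.∷-injectiveˡ eq) (sym nil≡) , allNil-intro xs (Vecₚ.∷-injectiveʳ eq)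

      padded-holds : ⟦ padded ⟧ t heap
      padded-holds = implies-intro λ m → allNil-intro pads
        (proj₂ (proj₂ (proj₂ (heap-elim {t 0} {t 1} {t 2} (pointsTo-elim {0} {1 ∷ 2 ∷ pads} {t} m)))))

      allocated-holds : ∀ {x} → τ x ∈ᵇ → ⟦ allocated x ⟧ t heap
      allocated-holds {x} x∈ = allocated-intro {x} {t}
        (heap-intro {t x} {left (τ x) , element (proj₁ c)} {right (τ x) , element (proj₂ c)} x∈ refl refl)
        where
        c : left (τ x) ∈ᵇ × right (τ x) ∈ᵇ
        c = subtrees-trans big (left-∈ (τ x)) x∈ , subtrees-trans big (right-∈ (τ x)) x∈

      closedˡ-holds : ⟦ closedˡ ⟧ t heap
      closedˡ-holds = implies-intro λ m → let x∈ , ey , _ = read-cell {0} {1} {2} m in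
        allocated-holds {1} (subst _∈ᵇ (sym ey) (subtrees-trans big (left-∈ (τ 0)) x∈))

      closedʳ-holds : ⟦ closedʳ ⟧ t heap
      closedʳ-holds = implies-intro λ m → let x∈ , _ , ez = read-cell {0} {1} {2} m in
        allocated-holds {2} (subst _∈ᵇ (sym ez) (subtrees-trans big (right-∈ (τ 0)) x∈))

      ν : ℕ → Tree
      ν = unfold left right τ (τ 0)

      unfolded-elim : ∀ m ps → ⟦ unfolded m ps ⟧ t heap → Links left right τ m ps
      unfolded-elim m []       _        = tt
      unfolded-elim m (q ∷ ps) (c , ms) = proj₂ (read-cell {q} {m} {suc m} c) , unfolded-elim (2 + m) ps ms

      τ-ν : Links left right τ 1 parents → ∀ v → τ v ≡ ν v
      τ-ν links v with v <? 47
      ... | yes v< = links-unique {l = left} {right} {τ} {ν} 1 parents parents-ordered links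
                       (unfold-links left right τ (τ 0))
                       (λ { zero _ → refl ; (suc v) (s≤s ()) }) v v<
      ... | no  v≮ = sym (unfold-beyond left right τ (τ 0) v (≮⇒≥ v≮))

      value-τ : Links left right τ 1 parents → ∀ x → τ ⟨ x ⟩ ≡ value ν leaf x
      value-τ links (# i) = τ-ν links i
      value-τ links (κ i) = τ-leaf (toℕ i) (<-trans (toℕ<n i) (s≤s (s≤s (s≤s (s≤s z≤n)))))

      equations-elim : ∀ es → Links left right τ 1 parents → ⟦ equations es ⟧ t heap → Solves ν leaf es
      equations-elim []             links _          = tt
      equations-elim ((x , y) ∷ es) links (eq , eqs) =
        trans (sym (value-τ links x)) (trans (cong proj₁ eq) (value-τ links y)) , equations-elim es links eqs

      equations-intro : ∀ es → Links left right τ 1 parents → Solves ν leaf es → ⟦ equations es ⟧ t heap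
      equations-intro []             links _          = tt
      equations-intro ((x , y) ∷ es) links (eq , eqs) =
        U-≡ (trans (value-τ links x) (trans eq (sym (value-τ links y)))) , equations-intro es links eqs

      ruleList-intro : ∀ i ρs → (Links left right τ 1 parents → τ 0 ∈ᵇ → ν 1 ≡ leaf 2 → ν 11 ≡ τ (bv i) →
        All (Obeys ν leaf) ρs) → ⟦ ruleList i ρs ⟧ t heap
      ruleList-intro i []               _    = tt
      ruleList-intro i ((es , fs) ∷ ρs) obey =
        implies-intro (λ { (unf , j , e , eqs) → apply unf (cong proj₁ j) (cong proj₁ e) eqs }) ,
        ruleList-intro i ρs λ links c∈ j e → All.tail (obey links c∈ j e)
        where
        apply : ⟦ unfolded 1 parents ⟧ t heap → τ 1 ≡ τ (bv 2) → τ 11 ≡ τ (bv i) → ⟦ equations es ⟧ t heap →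
          ⟦ equations fs ⟧ t heap
        apply unf j e eqs = equations-intro fs links
          (All.head (obey links (proj₁ (read-cell {0} {1} {2} (proj₁ unf)))
            (trans (sym (τ-ν links 1)) (trans j (τ-leaf 2 (s≤s (s≤s (s≤s z≤n))))))
            (trans (sym (τ-ν links 11)) e))
            (equations-elim es links eqs))
          where
          links : Links left right τ 1 parents
          links = unfolded-elim 1 parents unf

      ruleTable-holds : ∀ N → N ≤ 12 → ⟦ ruleTable N ⟧ t heap
      ruleTable-holds zero    _   = tt
      ruleTable-holds (suc i) i<N =
        ruleList-intro i (rules i) (λ links c∈ j e →
          good-lawful big big-good c∈ τ j i (trans e (τ-leaf i i<N))) ,
        ruleTable-holds i (<⇒≤ i<N)

      -- `us` is the part of the preorder list that follows `u`. With it the hypothesis is stable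
      -- under descent: the left child sees the right sibling as part of its rest, and `entry-++`
      -- skips the left subtree for the right child.
      describe-holds : ∀ b u us → (∀ i → environment (b + i) ≡ entry constants (subtrees u ++ us) i) →
        Labels (λ i → environment i ≡ constants i) u → ⟦ describe b u ⟧ t heap
      describe-holds b (leaf i) us at lab = U-≡ (trans (t-env b) (trans
        (trans (cong environment (sym (+-identityʳ b))) (at 0)) (trans (sym lab) (sym (t-env i)))))
      describe-holds b (node q q′) us at (lab , lab′) =
        make-cell {bv b} {bv (suc b)} {bv (suc b + size q)} (subst _∈ᵇ (sym (t-env b)) (environment-∈ b))
          (trans (trans (t-env (suc b)) (root-at (suc b) q _ at-q)) (cong left (sym whole)))
          (trans (trans (t-env (suc b + size q)) (root-at (suc b + size q) q′ _ at-q′))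
                 (cong right (sym whole))) ,
        describe-holds (suc b) q (subtrees q′ ++ us) at-q lab ,
        describe-holds (suc b + size q) q′ us at-q′ lab′
        where
        root-at : ∀ b u us → (∀ i → environment (b + i) ≡ entry constants (subtrees u ++ us) i) →
          environment b ≡ fill constants u
        root-at b u us at = trans (cong environment (sym (+-identityʳ b))) (trans (at 0) (entry-root u us))
        whole : τ (bv b) ≡ fill constants (node q q′)
        whole = trans (t-env b) (root-at b (node q q′) us at)
        at-q : ∀ i → environment (suc b + i) ≡ entry constants (subtrees q ++ subtrees q′ ++ us) i
        at-q i = trans (cong environment (sym (+-suc b i))) (trans (at (suc i))
          (cong (λ ts → entry constants ts i) (++-assoc (subtrees q) (subtrees q′) us)))
        at-q′ : ∀ i → environment (suc b + size q + i) ≡ entry constants (subtrees q′ ++ us) i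
        at-q′ i = trans (cong environment (+-assoc (suc b) (size q) i))
          (trans (at-q (size q + i)) (entry-++ (subtrees q) (subtrees q′ ++ us) i))

      frame-holds : ⟦ frame p ⟧ t heap
      frame-holds = padded-holds , closedˡ-holds , closedʳ-holds , ruleTable-holds 12 ≤-refl ,
        make-cell {bv 0} {bv 0} {bv 0} (subst _∈ᵇ (sym (τ-leaf 0 (s≤s z≤n))) (leaf-∈ 0 (s≤s z≤n)))
          (trans (τ-leaf 0 (s≤s z≤n)) (cong left (sym (τ-leaf 0 (s≤s z≤n)))))
          (trans (τ-leaf 0 (s≤s z≤n)) (cong right (sym (τ-leaf 0 (s≤s z≤n))))) ,
        (λ eq → nil≢one (trans (sym (τ-leaf 0 (s≤s z≤n))) (trans (cong proj₁ eq) (τ-leaf 1 (s≤s (s≤s z≤n)))))) ,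
        describe-holds 14 (claim p) []
          (λ i → cong (λ ts → entry constants ts i) (sym (++-identityʳ (subtrees (claim p)))))
          claim-labels
        where
        nil≢one : leaf 0 ≢ leaf 1
        nil≢one ()

    -- The store is split below and above chainVar n 0: the frame lives below it by frame-below.
    target : Var → Tree
    target v = if v <ᵇ chainVar n 0 then environment (v ∸ bv 0) else numeral (v ∸ chainVar n 0)

    embed : (t : Tree) → Dec (t ∈ᵇ) → U
    embed t (yes t∈) = t , element t∈
    embed t (no _)   = nilᵁ

    ι : Tree → U
    ι t = embed t (t ∈? subtrees big)

    ι-∈ : ∀ {t} → t ∈ᵇ → proj₁ (ι t) ≡ t
    ι-∈ {t} t∈ with t ∈? subtrees big
    ... | yes _  = refl
    ... | no  t∉ = contradiction t∈ t∉

    store : Store U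
    store v = ι (target v)

    bv-∸ : ∀ i → bv i ∸ bv 0 ≡ i
    bv-∸ i = [m+n]∸[m+o]≡n∸o k′ i 0

    chainVar-∸ : ∀ i → chainVar n i ∸ chainVar n 0 ≡ i
    chainVar-∸ i = trans ([m+n]∸[m+o]≡n∸o k′ (14 + (n + i)) (14 + (n + 0))) ([m+n]∸[m+o]≡n∸o n i 0)

    bv-mono : ∀ {i j} → i ≤ j → bv i ≤ bv j
    bv-mono i≤j = +-monoʳ-≤ 47 (+-monoʳ-≤ k′ i≤j)

    n<chainVar : n < chainVar n 0
    n<chainVar = s≤s (≤-trans (≤-trans (m≤m+n n 0) (m≤n+m (n + 0) 14)) (≤-trans (m≤n+m _ k′) (m≤n+m _ 46)))

    target-low : ∀ {v} → v < chainVar n 0 → target v ≡ environment (v ∸ bv 0)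
    target-low v< = if-< v<

    module _ (t : Store U) (t-store : ∀ v → bv 0 ≤ v → t v ≡ store v) where

      -- `frame-holds` asks all variables `bv i` to follow `environment`, whereas the store holds
      -- numerals from `chainVar n 0` on. The frame mentions none of those variables, so
      -- `coincidence` carries its truth from `patched` back to `t`.
      patched : Store U
      patched v = if v <ᵇ bv 0 then t v else ι (environment (v ∸ bv 0))

      patched-env : ∀ i → proj₁ (patched (bv i)) ≡ environment i
      patched-env i = trans (cong proj₁ (if-≥ {v = bv i} (bv-mono {0} {i} z≤n)))
        (trans (ι-∈ (environment-∈ (bv i ∸ bv 0))) (cong environment (bv-∸ i)))

      patched-agrees : ∀ v → Free v (frame p) → patched v ≡ t v
      patched-agrees v v∈ with v <? bv 0
      ... | yes v< = if-< v<
      ... | no  v≮ = trans (if-≥ {v = v} (≮⇒≥ v≮)) (sym (trans (t-store v (≮⇒≥ v≮))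
                       (cong ι (target-low (≤-<-trans (frame-below v v∈) n<chainVar)))))

      t-constant : ∀ i → i ≤ 13 → proj₁ (t (bv i)) ≡ environment i
      t-constant i i≤ = trans (cong proj₁ (trans (t-store (bv i) (bv-mono z≤n))
          (cong ι (trans (target-low (+-monoʳ-< 47 (+-monoʳ-< k′ (≤-<-trans i≤ (s≤s (m≤m+n 13 (n + 0)))))))
                         (cong environment (bv-∸ i))))))
        (ι-∈ (environment-∈ i))

      t-chain : ∀ i → i ≤ n → proj₁ (t (chainVar n i)) ≡ numeral i
      t-chain i i≤ = trans (cong proj₁ (trans (t-store (chainVar n i) (bv-mono {0} {14 + (n + i)} z≤n))
          (cong ι (trans (if-≥ {v = chainVar n i}
                           (bv-mono {14 + (n + 0)} {14 + (n + i)} (+-monoʳ-≤ 14 (+-monoʳ-≤ n z≤n))))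
                         (cong numeral (chainVar-∸ i))))))
        (ι-∈ (numeral-∈ i i≤))

      chain-holds : ∀ i → i ≤ n → ⟦ chain n i ⟧ t heap
      chain-holds zero    i≤ = U-≡ (trans (t-chain 0 i≤) (sym (t-constant 0 z≤n)))
      chain-holds (suc i) i≤ =
        cell-intro {chainVar n (suc i)} {chainVar n i} {bv 1} {t} heap-finite
          (trans (heap-intro {t (chainVar n (suc i))} {t (chainVar n i)} {t (bv 1)}
                   (subst _∈ᵇ (sym at) (numeral-∈ (suc i) i≤))
                   (trans (t-chain i (<⇒≤ i≤)) (cong left (sym at)))
                   (trans (t-constant 1 (s≤s z≤n)) (cong right (sym at))))
                 (cong (λ u → just (row u (t (chainVar n i)) (t (bv 1))))
                       (sym (U-≡ {u = t (bv 0)} {nilᵁ} (t-constant 0 z≤n))))) ,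
        chain-holds i (<⇒≤ i≤)
        where
        at : proj₁ (t (chainVar n (suc i))) ≡ numeral (suc i)
        at = t-chain (suc i) i≤

      matrix-holds : ⟦ frame p ∧ inputIs n ⟧ t heap
      matrix-holds = coincidence (frame p) (frame-qf p) patched-agrees (frame-holds patched patched-env) ,
        U-≡ (trans (t-constant 12 (m≤m+n 12 1)) (sym (t-chain n ≤-refl))) , chain-holds n ≤-refl

    structure : Structure k
    structure = record
      { U = U ; elt = nilᵁ ; enc = λ u → codeᵗ (proj₁ u) ; enc-inj = λ eq → U-≡ (codeᵗ-injective _ _ eq)
      ; store = store ; heap = heap ; heap-fin = heap-finite }

    structure-models : ∀ E → Exs E (Alls (downFrom (bv 0)) (λ t → ⟦ frame p ∧ inputIs n ⟧ t heap)) store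
    structure-models = prenex-intro (frame p ∧ inputIs n) (matrix-qf p n) (bv 0) matrix-holds

  -- The diagonal argument

  module Reduction (f : PR 1) where

    decider : Prog
    decider = compile (compF f (proj₁ diagonal-computable ∷ []))

    -- The frame and the sentence are kept behind equations so that no concrete code is ever evaluated.
    module _ (φ : Formula k) (qf : IsQF (φ ∧ inputIs (codeF φ))) (ψ : BSR k)
      (φ≡ : frame decider ≡ φ) (ψ≡ : close (bv 0) (φ ∧ inputIs (codeF φ)) qf ≡ ψ) where

      input : Tree
      input = tuple (codeF φ ∷ [])

      run : ∀ {y} → f ∙ (code ψ ∷ []) ⇓ y → Eval decider input (numeral y)
      run d = eval-compile {f = compF f (proj₁ diagonal-computable ∷ [])} (comp⇓ (∷⇓ computes []⇓) d)
        where
        computes : proj₁ diagonal-computable ∙ (codeF φ ∷ []) ⇓ code ψ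
        computes = subst (λ ψ → proj₁ diagonal-computable ∙ (codeF φ ∷ []) ⇓ code ψ) ψ≡
          (proj₂ diagonal-computable φ qf)

      refute : ∀ M → Models M ψ → ¬ Eval decider input (numeral 1)
      refute M m = Soundness.no-value-one U _≟ᵁ_ decider (codeF φ) heap heap-fin (proj₁ opened)
        (subst (λ ψ → Alls (downFrom (bv 0)) (λ t → ⟦ ψ ⟧ t heap) (proj₁ opened))
               (cong (_∧ inputIs (codeF φ)) (sym φ≡)) (proj₂ opened))
        where
        open Structure M
        open Sem U {k}
        opened : Σ (Store U) (Alls (downFrom (bv 0)) (λ t → ⟦ φ ∧ inputIs (codeF φ) ⟧ t heap))
        opened = close-elim M ψ≡ m
        _≟ᵁ_ : DecidableEquality U
        u ≟ᵁ v with enc u ≟ enc v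
        ... | yes same = yes (enc-inj same)
        ... | no  diff = no λ u≡v → diff (cong enc u≡v)

      module _ (M : Structure k) where
        open Structure M
        open Sem U {k}

        models-intro :
          (∀ E → Exs E (Alls (downFrom (bv 0)) (λ t → ⟦ frame decider ∧ inputIs (codeF φ) ⟧ t heap)) store) →
          Models M ψ
        models-intro m = close-intro M ψ≡ λ E →
          subst (λ χ → Exs E (Alls (downFrom (bv 0)) (λ t → ⟦ χ ⟧ t heap)) store)
                (cong (_∧ inputIs (codeF φ)) φ≡) (m E)

      module _ (d : Eval decider input (numeral 0)) where

        D : Derivation decider input (numeral 0)
        D = proj₁ (derive d (plain-numeral (codeF φ) , λ ()))

        -- The twelve leaves are added so that every constant named by the sentence has a cell,
        -- including labels that the derivation itself may not contain.
        big : Tree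
        big = withLeaves 12 (tree D)

        frame-below : ∀ v → Free v (frame decider) → v ≤ codeF φ
        frame-below v v∈ = free-≤-code φ (subst (Free v) φ≡ v∈)

        module _ (isElement : Tree → Bool) (element : ∀ {t} → t ∈ subtrees big → T (isElement t)) where

          model : Structure k
          model = Completeness.structure decider (codeF φ) D frame-below big (withLeaves-good 12 (good D))
            (withLeaves-self 12 (tree D)) (withLeaves-leaf 12 (tree D)) isElement element

          model-models : Models model ψ
          model-models = models-intro model
            (Completeness.structure-models decider (codeF φ) D frame-below big (withLeaves-good 12 (good D))
              (withLeaves-self 12 (tree D)) (withLeaves-leaf 12 (tree D)) isElement element)

        finite-model : FinSat ψ
        finite-model = model isSubtree fromWitness ,
          listed-finite (elements isSubtree fromWitness (subtrees big) (λ t∈ → t∈))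
            (λ u → elements-∈ isSubtree fromWitness u (subtrees big) (λ t∈ → t∈) (toWitness (proj₂ u))) ,
          model-models isSubtree fromWitness
          where
          isSubtree : Tree → Bool
          isSubtree t = ⌊ t ∈? subtrees big ⌋

        infinite-model : InfSat ψ
        infinite-model = model (λ _ → true) (λ _ → tt) ,
          ℕ-embeds-infinite (λ i → leaf i , tt) (λ { refl → refl }) ,
          model-models (λ _ → true) (λ _ → tt)

      -- No case distinction on satisfiability is made: a model would force the answer 1, which that
      -- model refutes, so `unsat` holds outright, and the resulting answer 0 produces a model.
      undecided : ∀ (Sat : BSR k → Set₁) → (∀ ψ → Sat ψ → Σ (Structure k) λ M → Models M ψ) →
        (Eval decider input (numeral 0) → Sat ψ) →
        ¬ Decides f Sat
      undecided Sat model satisfiable decides = unsat (satisfiable (run (proj₂ (decides ψ) unsat)))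
        where
        unsat : ¬ Sat ψ
        unsat sat = refute (proj₁ (model _ sat)) (proj₂ (model _ sat)) (run (proj₁ (decides ψ) sat))

    undecidable : ∀ φ (qf : IsQF (φ ∧ inputIs (codeF φ))) ψ →
      frame decider ≡ φ → close (bv 0) (φ ∧ inputIs (codeF φ)) qf ≡ ψ →
      ¬ Decides f FinSat × ¬ Decides f InfSat
    undecidable φ qf ψ φ≡ ψ≡ =
      undecided φ qf ψ φ≡ ψ≡ FinSat (λ { _ (M , _ , m) → M , m }) (finite-model φ qf ψ φ≡ ψ≡) ,
      undecided φ qf ψ φ≡ ψ≡ InfSat (λ { _ (M , _ , m) → M , m }) (infinite-model φ qf ψ φ≡ ψ≡)

    conclusion : ¬ Decides f FinSat × ¬ Decides f InfSat
    conclusion = undecidable (frame decider) (matrix-qf decider (codeF (frame decider)))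
      (close (bv 0) (frame decider ∧ inputIs (codeF (frame decider))) (matrix-qf decider (codeF (frame decider))))
      refl refl

theorem1 : (k : ℕ) → 2 ≤ k →
    ¬ Decidable (FinSat {k}) × ¬ Decidable (InfSat {k})
theorem1 (suc (suc k′)) (s≤s (s≤s z≤n)) =
  (λ { (f , decides) → proj₁ (Sentence.Reduction.conclusion k′ f) decides }) ,
  (λ { (f , decides) → proj₂ (Sentence.Reduction.conclusion k′ f) decides })
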